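{- Let $w\in\Sigma_2^\omega$ be an infinite binary word that is rich and $14/5$-free. Then for every integer $n\geq 1$, some suffix of $w$ has the form $f(h^n(w_n))$ or the form $f(g(h^n(w_n)))$ for some infinite word $w_n\in\Sigma_3^\omega$.
   Context: $\Sigma_k=\{0,1,\dots,k-1\}$. The morphisms $f:\Sigma_3^*\to\Sigma_2^*$ and $g,h:\Sigma_3^*\to\Sigma_3^*$ are defined by $f(0)=0$, $f(1)=01$, $f(2)=011$; $g(0)=011$, $g(1)=0121$, $g(2)=012121$; $h(0)=01$, $h(1)=02$, $h(2)=022$ (extended to infinite words letterwise). A finite word of length $n$ is rich if it has $n$ distinct nonempty palindromic factors; an infinite word is rich if all of its finite factors are rich. A finite word $u=u_1\cdots u_m$ has period $p$ if $u_i=u_{i+p}$ for $1\le i\le m-p$, and then $m/p$ is an exponent of $u$. For real $\alpha\ge1$, a word is $\alpha$-free if it contains no nonempty factor having an exponent $\ge\alpha$. -}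

module Defs where

open import Data.Nat using (ℕ; zero; suc; _+_; _*_; _≤_; _<_)
open import Data.Fin using (Fin; zero; suc)
open import Data.Fin.Properties using () renaming (_≟_ to _≟F_)
open import Data.List using (List; []; _∷_; [_]; length; map; upTo; concatMap; reverse; filter; deduplicate; drop; take; _++_)
open import Data.List.Properties using (≡-dec)
open import Data.Product using (Σ; _×_; ∃)
open import Relation.Binary.PropositionalEquality using (_≡_)
open import Relation.Nullary using (¬_; Dec)

Alph : ℕ → Set
Alph k = Fin k

Word∞ : ℕ → Set
Word∞ k = ℕ → Alph k

Morphism : ℕ → ℕ → Set
Morphism a b = Alph a → List (Alph b)

apply : ∀ {a b} → Morphism a b → List (Alph a) → List (Alph b)
apply φ = concatMap φ

_∘ᵐ_ : ∀ {a b c} → Morphism b c → Morphism a b → Morphism a c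
(φ ∘ᵐ ψ) x = apply φ (ψ x)

_^ᵐ_ : ∀ {a} → Morphism a a → ℕ → Morphism a a
(φ ^ᵐ zero) x = [ x ]
(φ ^ᵐ suc n) x = apply φ ((φ ^ᵐ n) x)

0₃ 1₃ 2₃ : Alph 3
0₃ = zero
1₃ = suc zero
2₃ = suc (suc zero)

0₂ 1₂ : Alph 2
0₂ = zero
1₂ = suc zero

f : Morphism 3 2
f zero = 0₂ ∷ []
f (suc zero) = 0₂ ∷ 1₂ ∷ []
f (suc (suc zero)) = 0₂ ∷ 1₂ ∷ 1₂ ∷ []

g : Morphism 3 3
g zero = 0₃ ∷ 1₃ ∷ 1₃ ∷ []
g (suc zero) = 0₃ ∷ 1₃ ∷ 2₃ ∷ 1₃ ∷ []
g (suc (suc zero)) = 0₃ ∷ 1₃ ∷ 2₃ ∷ 1₃ ∷ 2₃ ∷ 1₃ ∷ []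

h : Morphism 3 3
h zero = 0₃ ∷ 1₃ ∷ []
h (suc zero) = 0₃ ∷ 2₃ ∷ []
h (suc (suc zero)) = 0₃ ∷ 2₃ ∷ 2₃ ∷ []

prefix : ∀ {k} → Word∞ k → ℕ → List (Alph k)
prefix w n = map w (upTo n)

factor : ∀ {k} → Word∞ k → ℕ → ℕ → List (Alph k)
factor w i m = map (λ j → w (i + j)) (upTo m)

suffix : ∀ {k} → Word∞ k → ℕ → Word∞ k
suffix w i j = w (i + j)

-- s = φ(u) for an infinite word u (φ non-erasing): s is the limit of the
-- images of the prefixes of u, i.e. every φ(u_0 … u_{m-1}) is a prefix of s.
IsImage : ∀ {a b} → Morphism a b → Word∞ a → Word∞ b → Set
IsImage φ u s = ∀ m → apply φ (prefix u m) ≡ prefix s (length (apply φ (prefix u m)))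

nonemptyFactors : ∀ {k} → List (Alph k) → List (List (Alph k))
nonemptyFactors [] = []
nonemptyFactors (x ∷ xs) = map (λ n → take (suc n) (x ∷ xs)) (upTo (length (x ∷ xs))) ++ nonemptyFactors xs

_≟W_ : ∀ {k} → (u v : List (Alph k)) → Dec (u ≡ v)
_≟W_ = ≡-dec _≟F_

isPalindrome? : ∀ {k} → (u : List (Alph k)) → Dec (reverse u ≡ u)
isPalindrome? u = reverse u ≟W u

palFactors : ∀ {k} → List (Alph k) → List (List (Alph k))
palFactors u = deduplicate _≟W_ (filter isPalindrome? (nonemptyFactors u))

RichFin : ∀ {k} → List (Alph k) → Set
RichFin u = length (palFactors u) ≡ length u

Rich : ∀ {k} → Word∞ k → Set
Rich w = ∀ i m → RichFin (factor w i m)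

HasPeriod : ∀ {k} → Word∞ k → ℕ → ℕ → ℕ → Set
HasPeriod w i m p = ∀ j → j + p < m → w (i + j) ≡ w (i + j + p)

-- (a/b)-free: no nonempty factor (length m ≥ 1) with a period p ≥ 1
-- such that m/p ≥ a/b, i.e. b*m ≥ a*p.
Free : ∀ {k} → ℕ → ℕ → Word∞ k → Set
Free a b w = ¬ (Σ ℕ λ i → Σ ℕ λ m → Σ ℕ λ p →
                 (1 ≤ m) × (1 ≤ p) × (a * p ≤ b * m) × HasPeriod w i m p)

{-# OPTIONS --safe #-}
-- In a rich word every complete return to a palindrome is a palindrome.  Each of f, g and h sends a
-- letter to 0 followed by a 0-free palindrome, so this property passes from φ(v) to v.  Repetitions
-- are followed the other way: when w is read in blocks coded by u, a repetition in u becomes one in w,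
-- prolonged on both sides by the common prefixes and suffixes of the blocks where the letters of u
-- first disagree.  The lengths of the blocks and of these prolongations satisfy linear inequalities
-- preserved by h, so at every level the same finitely many words are excluded from u by a repetition
-- of exponent at least 14/5 or by a non-palindromic return, and avoiding them makes u a concatenation
-- of the words 01, 02, 022.  At the level of f, longer excluded words force one of the two block sets
-- {01, 02, 022} and {011, 0121, 012121} to be used throughout.
module Submission where

open import Defs
open import Data.Bool using (Bool; true; false; T; _∨_; if_then_else_; not)
open import Data.Bool.ListAction using (any; all)
open import Data.Bool.Properties using (T-∨)
open import Data.Char using (Char; toℕ)
open import Data.Empty using (⊥; ⊥-elim)
open import Data.Fin using (zero; suc)
open import Data.Fin.Properties using () renaming (_≟_ to _≟F_)
open import Data.List using (List; []; _∷_; [_]; length; map; upTo; applyUpTo; allFin; null; take; drop; reverse; _++_)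
open import Data.List.Membership.DecPropositional as DecMembership using ()
open import Data.List.Membership.Propositional using (_∈_; find)
open import Data.List.Membership.Propositional.Properties
open import Data.List.Properties
open import Data.List.Relation.Binary.Subset.Propositional using (_⊆_)
open import Data.List.Relation.Unary.All as All using (All; []; _∷_)
import Data.List.Relation.Unary.All.Properties as Allₚ
open import Data.List.Relation.Unary.AllPairs using ([]; _∷_)
open import Data.List.Relation.Unary.Any as Any using (Any; here; there; any?; satisfied)
import Data.List.Relation.Unary.Any.Properties as Anyₚ
import Data.List.Relation.Unary.Unique.DecPropositional.Properties as Uniqueₚ
open import Data.List.Relation.Unary.Unique.Propositional using (Unique)
open import Data.Nat
open import Data.Nat.Properties
open import Data.Nat.Tactic.RingSolver using (solve-∀)
open import Data.Product using (Σ; ∃; _×_; _,_; proj₁; proj₂)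
open import Data.String using (String; words; toList) renaming (_++_ to _++ˢ_)
open import Data.Sum as Sum using (_⊎_; inj₁; inj₂)
open import Data.Unit using (tt)
open import Data.Vec as Vec using (Vec)
open import Data.Vec.Properties using (lookup∘tabulate)
open import Function using (_∘_; id; const; Equivalence)
open import Relation.Binary.PropositionalEquality hiding ([_])
open import Relation.Nullary using (¬_; yes; no; does; ¬?; _×-dec_; decidable-stable)
open import Relation.Nullary.Decidable using (isNo; toWitnessFalse)
open ≡-Reasoning

private variable
  a b c k : ℕ

-- Factors of infinite words

seg : Word∞ k → ℕ → ℕ → List (Alph k)
seg w i zero = []
seg w i (suc n) = w i ∷ seg w (suc i) n

length-seg : ∀ (w : Word∞ k) i n → length (seg w i n) ≡ n
length-seg w i zero = refl
length-seg w i (suc n) = cong suc (length-seg w (suc i) n)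

seg-++ : ∀ (w : Word∞ k) i m n → seg w i (m + n) ≡ seg w i m ++ seg w (m + i) n
seg-++ w i zero n = refl
seg-++ w i (suc m) n = cong (w i ∷_) (trans (seg-++ w (suc i) m n)
  (cong (λ j → seg w (suc i) m ++ seg w j n) (+-suc m i)))

seg-applyUpTo : ∀ (w : Word∞ k) i n (φ : ℕ → Alph k) → (∀ j → φ j ≡ w (i + j)) →
  applyUpTo φ n ≡ seg w i n
seg-applyUpTo w i zero φ eq = refl
seg-applyUpTo w i (suc n) φ eq = cong₂ _∷_ (trans (eq 0) (cong w (+-identityʳ i)))
  (seg-applyUpTo w (suc i) n (φ ∘ suc) λ j → trans (eq (suc j)) (cong w (+-suc i j)))

factor≡seg : ∀ (w : Word∞ k) i n → factor w i n ≡ seg w i n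
factor≡seg w i n = trans (map-upTo _ n) (seg-applyUpTo w i n _ λ _ → refl)

prefix≡seg : ∀ (w : Word∞ k) n → prefix w n ≡ seg w 0 n
prefix≡seg w n = trans (map-upTo w n) (seg-applyUpTo w 0 n _ λ _ → refl)

seg-suffix : ∀ (w : Word∞ k) i j n → seg (suffix w i) j n ≡ seg w (i + j) n
seg-suffix w i j zero = refl
seg-suffix w i j (suc n) = cong (w (i + j) ∷_)
  (trans (seg-suffix w i (suc j) n) (cong (λ m → seg w m n) (+-suc i j)))

infix 4 _⊑_

_⊑_ : List (Alph k) → Word∞ k → Set
x ⊑ w = ∃ λ i → seg w i (length x) ≡ x

⊑-suffix : ∀ {x} {w : Word∞ k} i → x ⊑ suffix w i → x ⊑ w
⊑-suffix {x = x} {w} i (j , eq) = i + j , trans (sym (seg-suffix w i j (length x))) eq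

seg-split : ∀ (w : Word∞ k) i x y → seg w i (length (x ++ y)) ≡ x ++ y →
  seg w i (length x) ≡ x × seg w (length x + i) (length y) ≡ y
seg-split w i [] y eq = refl , eq
seg-split w i (a ∷ x) y eq with seg-split w (suc i) x y (∷-injectiveʳ eq)
... | p , q = cong₂ _∷_ (∷-injectiveˡ eq) p ,
  trans (cong (λ j → seg w j (length y)) (sym (+-suc (length x) i))) q

-- Words read backwards from their last letter, so that a search extends them by one cons.
back : Word∞ k → ℕ → ℕ → List (Alph k)
back w i zero = []
back w i (suc n) = w (n + i) ∷ back w i n

back≡reverse : ∀ (w : Word∞ k) i n → back w i n ≡ reverse (seg w i n)
back≡reverse w i zero = refl
back≡reverse w i (suc n) = trans (snoc w i n) (trans (cong (_++ [ w i ]) (back≡reverse w (suc i) n))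
  (sym (unfold-reverse (w i) (seg w (suc i) n))))
  where
  snoc : ∀ (w : Word∞ _) i n → back w i (suc n) ≡ back w (suc i) n ++ [ w i ]
  snoc w i zero = refl
  snoc w i (suc n) = cong₂ _∷_ (cong w (sym (+-suc n i))) (snoc w i n)

back-++ : ∀ (w : Word∞ k) i m n → back w i (n + m) ≡ back w (m + i) n ++ back w i m
back-++ w i m zero = refl
back-++ w i m (suc n) = cong₂ _∷_ (cong w (+-assoc n m i)) (back-++ w i m n)

prefixOf : List (Alph k) → List (Alph k) → Bool
prefixOf [] y = true
prefixOf (a ∷ x) [] = false
prefixOf (a ∷ x) (b ∷ y) = if does (a ≟F b) then prefixOf x y else false

prefixOf-sound : ∀ (x y : List (Alph k)) → T (prefixOf x y) → ∃ λ z → y ≡ x ++ z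
prefixOf-sound [] y _ = y , refl
prefixOf-sound (a ∷ x) (b ∷ y) t with a ≟F b
... | yes refl = let z , eq = prefixOf-sound x y t in z , cong (a ∷_) eq

Avoids : List (Alph k) → Word∞ k → Set
Avoids x w = ∀ i → seg w i (length x) ≢ x

Avoids-suffix : ∀ {x} {w : Word∞ k} i → Avoids x w → Avoids x (suffix w i)
Avoids-suffix {x = x} {w} i av j eq = av (i + j) (trans (sym (seg-suffix w i j (length x))) eq)

-- Exhaustive search

-- Forbidden words are stored in a trie, which makes the exhaustive searches fast.
data Trie (k : ℕ) : Set where
  stop fail : Trie k
  node : Vec (Trie k) k → Trie k

-- The left quotient of the set by the letter `a`. Empty words may be dropped because `trie` tests
-- for them before taking quotients.
derive : Alph k → List (List (Alph k)) → List (List (Alph k))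
derive a [] = []
derive a ([] ∷ F) = derive a F
derive a ((b ∷ x) ∷ F) = if does (b ≟F a) then x ∷ derive a F else derive a F

-- The number bounds the depth. Where it runs out the trie says `fail`, so a forbidden word may be
-- overlooked but none is invented.
trie : ℕ → List (List (Alph k)) → Trie k
trie n [] = fail
trie zero F = fail
trie (suc n) F = if any null F then stop else node (Vec.tabulate λ a → trie n (derive a F))

hits : Trie k → List (Alph k) → Bool
hits stop r = true
hits fail r = false
hits (node ts) [] = false
hits (node ts) (a ∷ r) = hits (Vec.lookup ts a) r

BeginsWith : List (Alph k) → List (Alph k) → Set
BeginsWith r x = ∃ λ z → r ≡ x ++ z

derive-sound : ∀ a (F : List (List (Alph k))) {r} → Any (BeginsWith r) (derive a F) → Any (BeginsWith (a ∷ r)) F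
derive-sound a ([] ∷ F) p = there (derive-sound a F p)
derive-sound a ((b ∷ x) ∷ F) p with b ≟F a
derive-sound a ((b ∷ x) ∷ F) (here (z , eq)) | yes refl = here (z , cong (a ∷_) eq)
derive-sound a ((b ∷ x) ∷ F) (there p) | yes refl = there (derive-sound a F p)
... | no _ = there (derive-sound a F p)

hits-sound : ∀ n (F : List (List (Alph k))) r → T (hits (trie n F) r) → Any (BeginsWith r) F
hits-sound (suc n) F@(_ ∷ _) r t with any null F in eq
... | true = Any.map (λ { {[]} _ → r , refl }) (Anyₚ.any⁻ null F (subst T (sym eq) tt))
hits-sound (suc n) F@(_ ∷ _) (a ∷ r) t | false = derive-sound a F (hits-sound n (derive a F) r
  (subst (λ t → T (hits t r)) (lookup∘tabulate (λ a → trie n (derive a F)) a) t))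

-- If `back w i n` starts with the reversal of `x` and continues with `z`, then `x` occurs in `w` at
-- position `length z + i`.
avoids-back : ∀ (F : List (List (Alph k))) {w : Word∞ k} → All (λ x → Avoids x w) F →
  ∀ i n → ¬ Any (BeginsWith (back w i n)) (map reverse F)
avoids-back (x ∷ F) (_ ∷ avs) i n (there p) = avoids-back F avs i n p
avoids-back (x ∷ F) {w} (av ∷ _) i n (here (z , eq)) =
  av (length z + i) (reverse-injective (trans (sym (back≡reverse w (length z + i) (length x)))
    (proj₁ (split (length x) _ (length-reverse x) (trans (sym (back-++ w i (length z) (length x)))
      (trans (cong (back w i) len) eq))))))
  where
  length-back : ∀ (w : Word∞ _) i n → length (back w i n) ≡ n
  length-back w i zero = refl
  length-back w i (suc n) = cong suc (length-back w i n)
  len : length x + length z ≡ n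
  len = trans (cong (_+ length z) (sym (length-reverse x)))
    (trans (sym (length-++ (reverse x))) (trans (cong length (sym eq)) (length-back w i n)))
  split : ∀ m (y : List (Alph _)) {j : ℕ} {y′} → length y ≡ m → back w j m ++ y′ ≡ y ++ z →
    back w j m ≡ y × y′ ≡ z
  split zero [] p q = refl , q
  split (suc m) (a ∷ y) p q with split m y (suc-injective p) (∷-injectiveʳ q)
  ... | r , s = cong₂ _∷_ (∷-injectiveˡ q) r , s

-- A branch is closed as soon as a forbidden word ends at its newest letter; `goal` is tested on the
-- branches that survive all `n` extensions.
search : Trie k → ℕ → (List (Alph k) → Bool) → List (Alph k) → Bool
search t zero goal r = hits t r ∨ goal r
search {k} t (suc n) goal r = hits t r ∨ all (λ a → search t n goal (a ∷ r)) (allFin k)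

-- Follows the single branch spelled by `w` itself, which no forbidden word can close.
search-sound : ∀ (t : Trie k) {w : Word∞ k} → (∀ i n → ¬ T (hits t (back w i n))) →
  ∀ n goal i m → T (search t n goal (back w i m)) → T (goal (back w i (n + m)))
search-sound t av zero goal i m p with Equivalence.to T-∨ p
... | inj₁ p′ = ⊥-elim (av i m p′)
... | inj₂ p′ = p′
search-sound t {w} av (suc n) goal i m p with Equivalence.to T-∨ p
... | inj₁ p′ = ⊥-elim (av i m p′)
... | inj₂ p′ = subst (λ j → T (goal (back w i j))) (+-suc n m)
  (search-sound t av n goal i (suc m) (All.lookup
    (Allₚ.all⁺ (λ a → search t n goal (a ∷ back w i m)) (allFin _) p′) (∈-allFin (w (m + i)))))

unavoidableBy : Trie k → ℕ → ℕ → (List (Alph k) → Bool) → Bool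
unavoidableBy t m n goal = search t m (λ r → goal (reverse r) ∨ search t n (const false) r) []

-- Every word of length m avoiding F either meets goal or has no extension by n letters avoiding F.
unavoidable : List (List (Alph k)) → ℕ → ℕ → (List (Alph k) → Bool) → Bool
unavoidable F m n goal = unavoidableBy (trie (suc (m + n)) (map reverse F)) m n goal

-- The other outcome, a dead end, cannot arise inside `w`: the next `n` letters of `w` are an
-- extension that avoids `F`.
unavoidable-sound : ∀ (F : List (List (Alph k))) m n goal → T (unavoidable F m n goal) →
  ∀ {w : Word∞ k} → All (λ x → Avoids x w) F → ∀ i → T (goal (seg w i m))
unavoidable-sound {k} F m n goal p {w} av i = finish (Equivalence.to T-∨ (search-sound t avoided m _ i 0 p))
  where
  t : Trie k
  t = trie (suc (m + n)) (map reverse F)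
  avoided : ∀ i n → ¬ T (hits t (back w i n))
  avoided i n p = avoids-back F av i n (hits-sound _ _ (back w i n) p)
  finish : T (goal (reverse (back w i (m + 0)))) ⊎ T (search t n (const false) (back w i (m + 0))) →
    T (goal (seg w i m))
  finish (inj₁ p) = subst (T ∘ goal) (trans (cong reverse (trans (cong (back w i) (+-identityʳ m)) (back≡reverse w i m)))
    (reverse-involutive _)) p
  finish (inj₂ p) = ⊥-elim (search-sound t avoided n (const false) i (m + 0) p)

-- Coding by a morphism

start : Morphism a b → Word∞ a → ℕ → ℕ
start φ v zero = 0
start φ v (suc m) = length (φ (v m)) + start φ v m

-- The equation `u = φ(v)` stated block by block with explicit cutting positions, which the
-- arguments on repetitions refer to.
Coded : Morphism a b → Word∞ a → Word∞ b → Set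
Coded φ v u = ∀ m → seg u (start φ v m) (length (φ (v m))) ≡ φ (v m)

start-+ : ∀ (φ : Morphism a b) v i n → start φ v (n + i) ≡ length (apply φ (seg v i n)) + start φ v i
start-+ φ v i zero = refl
start-+ φ v i (suc n) = begin
  start φ v (suc n + i)             ≡⟨ cong (start φ v) (sym (+-suc n i)) ⟩
  start φ v (n + suc i)             ≡⟨ start-+ φ v (suc i) n ⟩
  ℓ + (length (φ (v i)) + s)        ≡⟨ sym (+-assoc ℓ _ s) ⟩
  (ℓ + length (φ (v i))) + s        ≡⟨ cong (_+ s) (+-comm ℓ _) ⟩
  (length (φ (v i)) + ℓ) + s        ≡⟨ cong (_+ s) (sym (length-++ (φ (v i)))) ⟩
  length (apply φ (seg v i (suc n))) + s ∎
  where
  ℓ = length (apply φ (seg v (suc i) n))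
  s = start φ v i

module _ {φ : Morphism a b} {v : Word∞ a} {u : Word∞ b} where

  coded-seg : Coded φ v u → ∀ i n →
    seg u (start φ v i) (length (apply φ (seg v i n))) ≡ apply φ (seg v i n)
  coded-seg cd i zero = refl
  coded-seg cd i (suc n) = begin
    seg u (start φ v i) (length (φ (v i) ++ y))                ≡⟨ cong (seg u (start φ v i)) (length-++ (φ (v i))) ⟩
    seg u (start φ v i) (length (φ (v i)) + length y)          ≡⟨ seg-++ u (start φ v i) (length (φ (v i))) (length y) ⟩
    seg u (start φ v i) (length (φ (v i))) ++ seg u (start φ v (suc i)) (length y)
                                                               ≡⟨ cong₂ _++_ (cd i) (coded-seg cd (suc i) n) ⟩
    φ (v i) ++ y ∎
    where
    y = apply φ (seg v (suc i) n)

  coded⇒image : Coded φ v u → IsImage φ v u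
  coded⇒image cd m = trans (sym eq) (sym (prefix≡seg u _))
    where
    eq : seg u 0 (length (apply φ (prefix v m))) ≡ apply φ (prefix v m)
    eq = subst (λ x → seg u 0 (length (apply φ x)) ≡ apply φ x) (sym (prefix≡seg v m)) (coded-seg cd 0 m)

  coded-suffix : Coded φ v u → ∀ i → Coded φ (suffix v i) (suffix u (start φ v i))
  coded-suffix cd i m = trans (seg-suffix u (start φ v i) _ _)
    (trans (cong (λ j → seg u j _) (shift m)) (cd (i + m)))
    where
    shift : ∀ m → start φ v i + start φ (suffix v i) m ≡ start φ v (i + m)
    shift zero = trans (+-identityʳ _) (cong (start φ v) (sym (+-identityʳ i)))
    shift (suc m) = begin
      start φ v i + (ℓ + start φ (suffix v i) m) ≡⟨ sym (+-assoc (start φ v i) ℓ _) ⟩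
      (start φ v i + ℓ) + start φ (suffix v i) m ≡⟨ cong (_+ start φ (suffix v i) m) (+-comm (start φ v i) ℓ) ⟩
      (ℓ + start φ v i) + start φ (suffix v i) m ≡⟨ +-assoc ℓ (start φ v i) _ ⟩
      ℓ + (start φ v i + start φ (suffix v i) m) ≡⟨ cong (ℓ +_) (shift m) ⟩
      start φ v (suc (i + m))                    ≡⟨ cong (start φ v) (sym (+-suc i m)) ⟩
      start φ v (i + suc m) ∎
      where
      ℓ = length (φ (v (i + m)))

  coded-cong : ∀ {ψ : Morphism a b} → (∀ x → φ x ≡ ψ x) → Coded φ v u → Coded ψ v u
  coded-cong {ψ} eq cd m = subst₂ (λ s x → seg u s (length x) ≡ x) (same m) (eq (v m)) (cd m)
    where
    same : ∀ m → start φ v m ≡ start ψ v m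
    same zero = refl
    same (suc m) = cong₂ _+_ (cong length (eq (v m))) (same m)

coded-≗ : ∀ {φ : Morphism a b} {v u u′} → (∀ i → u i ≡ u′ i) → Coded φ v u → Coded φ v u′
coded-≗ {φ = φ} {v} {u} {u′} eq cd m = trans (sym (seg-≗ _ _)) (cd m)
  where
  seg-≗ : ∀ i n → seg u i n ≡ seg u′ i n
  seg-≗ i zero = refl
  seg-≗ i (suc n) = cong₂ _∷_ (eq i) (seg-≗ (suc i) n)

coded-∘ : ∀ {φ : Morphism b c} {ψ : Morphism a b} {x v u} →
  Coded φ v u → Coded ψ x v → Coded (φ ∘ᵐ ψ) x u
coded-∘ {φ = φ} {ψ} {x} {v} {u} cφ cψ m = begin
  seg u (start (φ ∘ᵐ ψ) x m) (length (apply φ (ψ (x m)))) ≡⟨ cong (λ j → seg u j (length (apply φ (ψ (x m))))) (start-∘ m) ⟩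
  seg u (start φ v s) (length (apply φ (ψ (x m))))        ≡⟨ cong (λ y → seg u (start φ v s) (length (apply φ y))) (sym (cψ m)) ⟩
  seg u (start φ v s) (length (apply φ (seg v s n)))      ≡⟨ coded-seg cφ s n ⟩
  apply φ (seg v s n)                                     ≡⟨ cong (apply φ) (cψ m) ⟩
  apply φ (ψ (x m)) ∎
  where
  s = start ψ x m
  n = length (ψ (x m))
  start-∘ : ∀ m → start (φ ∘ᵐ ψ) x m ≡ start φ v (start ψ x m)
  start-∘ zero = refl
  start-∘ (suc m) = trans (cong₂ _+_ (cong (length ∘ apply φ) (sym (cψ m))) (start-∘ m))
    (sym (start-+ φ v (start ψ x m) (length (ψ (x m)))))

-- `Q` is an invariant of the cutting points. Iterating `step` yields the successive cutting points
-- in `state`, and the letters chosen on the way form `v`.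
desubstitute : ∀ (φ : Morphism a b) (u : Word∞ b) (Q : ℕ → Set) →
  (∀ i → Q i → ∃ λ x → seg u i (length (φ x)) ≡ φ x × Q (length (φ x) + i)) →
  ∀ i → Q i → ∃ λ v → Coded φ v (suffix u i)
desubstitute {a} {b} φ u Q step i q = v , coded
  where
  state : ℕ → Σ ℕ Q
  state zero = i , q
  state (suc m) = _ , proj₂ (proj₂ (step _ (proj₂ (state m))))
  v : Word∞ a
  v m = proj₁ (step _ (proj₂ (state m)))
  pos : ∀ m → i + start φ v m ≡ proj₁ (state m)
  pos zero = +-identityʳ i
  pos (suc m) = begin
    i + (ℓ + start φ v m) ≡⟨ sym (+-assoc i ℓ _) ⟩
    (i + ℓ) + start φ v m ≡⟨ cong (_+ start φ v m) (+-comm i ℓ) ⟩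
    (ℓ + i) + start φ v m ≡⟨ +-assoc ℓ i _ ⟩
    ℓ + (i + start φ v m) ≡⟨ cong (ℓ +_) (pos m) ⟩
    proj₁ (state (suc m)) ∎
    where ℓ = length (φ (v m))
  coded : Coded φ v (suffix u i)
  coded m = trans (seg-suffix u i (start φ v m) ℓ) (trans (cong (λ j → seg u j ℓ) (pos m))
    (proj₁ (proj₂ (step _ (proj₂ (state m))))))
    where ℓ = length (φ (v m))

-- Each block contains `zero` exactly once, at its start, so the occurrences of `zero` are the
-- cutting points and decoding is unique. Palindromic tails make the coding compatible with
-- reversal.
record Marked (φ : Morphism a (suc b)) : Set where
  field
    tail : Alph a → List (Alph (suc b))
    image : ∀ x → φ x ≡ zero ∷ tail x
    free : ∀ x → All (zero ≢_) (tail x)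
    injective : ∀ x y → tail x ≡ tail y → x ≡ y
    palindrome : ∀ x → reverse (tail x) ≡ tail x

-- Palindromic returns

-- Prefix and suffix occurrences of `p` are given separately so that they may overlap; `x ≢ []`
-- makes them distinct, and the last clause allows no third occurrence.
CompleteReturn : List (Alph a) → List (Alph a) → Set
CompleteReturn p r = (∃ λ y → r ≡ p ++ y) × (∃ λ x → x ≢ [] × r ≡ x ++ p)
  × (∀ x y → r ≡ x ++ p ++ y → x ≡ [] ⊎ y ≡ [])

ReturnsPalindromic : Word∞ a → Set
ReturnsPalindromic w = ∀ p r → r ⊑ w → p ≢ [] → reverse p ≡ p → CompleteReturn p r → reverse r ≡ r

module MarkedMorphism {φ : Morphism a (suc b)} (marked : Marked φ) where
  open Marked marked

  -- The extra `zero` bounds the last block on the right, so every tail is enclosed between two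
  -- markers. Palindromes and occurrences then translate exactly.
  close : List (Alph a) → List (Alph (suc b))
  close x = apply φ x ++ [ zero ]

  private
    free-++ : ∀ {q q′ : List (Alph (suc b))} {y y′} → All (zero ≢_) q → All (zero ≢_) q′ →
      q ++ zero ∷ y ≡ q′ ++ zero ∷ y′ → q ≡ q′ × y ≡ y′
    free-++ [] [] eq = refl , ∷-injectiveʳ eq
    free-++ [] (n ∷ _) eq = ⊥-elim (n (∷-injectiveˡ eq))
    free-++ (n ∷ _) [] eq = ⊥-elim (n (sym (∷-injectiveˡ eq)))
    free-++ (n ∷ z) (n′ ∷ z′) eq with free-++ z z′ (∷-injectiveʳ eq)
    ... | p , r = cong₂ _∷_ (∷-injectiveˡ eq) p , r

    free-split : ∀ {q : List (Alph (suc b))} {y} s {z} → All (zero ≢_) q → q ++ y ≡ s ++ zero ∷ z →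
      ∃ λ s′ → s ≡ q ++ s′ × y ≡ s′ ++ zero ∷ z
    free-split s [] eq = s , refl , eq
    free-split [] (n ∷ _) eq = ⊥-elim (n (sym (∷-injectiveˡ eq)))
    free-split (c ∷ s) (n ∷ f) eq with free-split s f (∷-injectiveʳ eq)
    ... | s′ , p , r = s′ , cong₂ _∷_ (sym (∷-injectiveˡ eq)) p , r

  close-∷ : ∀ x y → close (x ∷ y) ≡ zero ∷ tail x ++ close y
  close-∷ x y = trans (++-assoc (φ x) (apply φ y) _) (cong (_++ close y) (image x))

  close-++ : ∀ x y → close (x ++ y) ≡ apply φ x ++ close y
  close-++ x y = trans (cong (_++ [ zero ]) (concatMap-++ φ x y)) (++-assoc (apply φ x) _ _)

  close-zero : ∀ x → ∃ λ z → close x ≡ zero ∷ z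
  close-zero [] = [] , refl
  close-zero (x ∷ y) = _ , close-∷ x y

  close-≢[] : ∀ x → close x ≢ []
  close-≢[] x eq with () ← trans (sym (proj₂ (close-zero x))) eq

  close-[] : ∀ x → close x ≡ [ zero ] → x ≡ []
  close-[] [] _ = refl
  close-[] (x ∷ y) eq = ⊥-elim (close-≢[] y (++-conicalʳ (tail x) _
    (∷-injectiveʳ (trans (sym (close-∷ x y)) eq))))

  apply-[] : ∀ x → apply φ x ≡ [] → x ≡ []
  apply-[] [] _ = refl
  apply-[] (x ∷ y) eq with () ← trans (sym (cong (_++ apply φ y) (image x))) eq

  -- The reversal of a block `zero ∷ t` is `t` followed by `zero`; the final marker of `close` lets
  -- each such `zero` be attached to the following palindrome instead.
  close-reverse : ∀ x → reverse (close x) ≡ close (reverse x)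
  close-reverse [] = refl
  close-reverse (x ∷ y) = begin
    reverse (close (x ∷ y))                        ≡⟨ cong reverse (close-∷ x y) ⟩
    reverse ((zero ∷ tail x) ++ close y)           ≡⟨ reverse-++ (zero ∷ tail x) (close y) ⟩
    reverse (close y) ++ reverse (zero ∷ tail x)   ≡⟨ cong₂ _++_ (close-reverse y) (unfold-reverse zero (tail x)) ⟩
    close (reverse y) ++ reverse (tail x) ++ [ zero ]
                                                   ≡⟨ cong (λ z → close (reverse y) ++ z ++ [ zero ]) (palindrome x) ⟩
    close (reverse y) ++ tail x ++ [ zero ]        ≡⟨ ++-assoc (apply φ (reverse y)) _ _ ⟩
    apply φ (reverse y) ++ zero ∷ tail x ++ [ zero ]
                                                   ≡⟨ cong (apply φ (reverse y) ++_) (sym (close-∷ x [])) ⟩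
    apply φ (reverse y) ++ close [ x ]             ≡⟨ sym (close-++ (reverse y) [ x ]) ⟩
    close (reverse y ++ [ x ])                     ≡⟨ cong close (sym (unfold-reverse x y)) ⟩
    close (reverse (x ∷ y)) ∎

  -- `close p` ends in a marker, so its blocks are complete and must equal the first blocks of `r`.
  -- That last marker is shared with the remainder, hence the `zero` in front of `t`.
  decode-prefix : ∀ p r t → close p ++ t ≡ close r → ∃ λ r′ → r ≡ p ++ r′ × zero ∷ t ≡ close r′
  decode-prefix [] r t eq = r , refl , eq
  decode-prefix (x ∷ p) [] t eq = ⊥-elim (close-≢[] p (++-conicalʳ (tail x) _
    (++-conicalˡ _ t (∷-injectiveʳ (trans (sym (cong (_++ t) (close-∷ x p))) eq)))))
  decode-prefix (x ∷ p) (y ∷ r) t eq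
    with zp , ep ← close-zero p | zr , er ← close-zero r
    with qq , zz ← free-++ (free x) (free y) (∷-injectiveʳ (begin
      zero ∷ tail x ++ (zero ∷ zp) ++ t   ≡⟨ cong (λ z → zero ∷ tail x ++ z ++ t) (sym ep) ⟩
      (zero ∷ tail x) ++ close p ++ t     ≡⟨ sym (++-assoc (zero ∷ tail x) (close p) t) ⟩
      ((zero ∷ tail x) ++ close p) ++ t   ≡⟨ cong (_++ t) (sym (close-∷ x p)) ⟩
      close (x ∷ p) ++ t                  ≡⟨ eq ⟩
      close (y ∷ r)                       ≡⟨ close-∷ y r ⟩
      zero ∷ tail y ++ close r            ≡⟨ cong (λ z → zero ∷ tail y ++ z) er ⟩
      zero ∷ tail y ++ zero ∷ zr ∎))
    with r′ , e , e′ ← decode-prefix p r t (trans (cong (_++ t) ep) (trans (cong (zero ∷_) zz) (sym er)))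
    = r′ , cong₂ _∷_ (sym (injective x y qq)) e , e′

  close-injective : ∀ x y → close x ≡ close y → x ≡ y
  close-injective x y eq with decode-prefix x y [] (trans (++-identityʳ _) eq)
  ... | r , e , e′ = trans (sym (++-identityʳ x)) (sym (trans e (cong (x ++_) (close-[] r (sym e′)))))

  -- A `zero` inside `close r` can only be the start of a block or the final marker, so cutting
  -- there cuts `r` between two letters.
  decode-suffix : ∀ r s z → close r ≡ s ++ zero ∷ z →
    ∃ λ r₁ → ∃ λ r₂ → r ≡ r₁ ++ r₂ × s ≡ apply φ r₁ × zero ∷ z ≡ close r₂
  decode-suffix r [] z eq = [] , r , refl , refl , sym eq
  decode-suffix [] (c ∷ []) z ()
  decode-suffix [] (c ∷ _ ∷ _) z ()
  decode-suffix (x ∷ r) (c ∷ s) z eq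
    with eq′ ← trans (sym (close-∷ x r)) eq
    with s′ , e , e′ ← free-split s (free x) (∷-injectiveʳ eq′)
    with r₁ , r₂ , p , p′ , p″ ← decode-suffix r s′ z e′
    = x ∷ r₁ , r₂ , cong (x ∷_) p
    , trans (cong₂ _∷_ (sym (∷-injectiveˡ eq′)) (trans e (cong (tail x ++_) p′)))
        (cong (_++ apply φ r₁) (sym (image x)))
    , p″

  -- An occurrence of `close p` in `close r` starts and ends at markers, so it comes from an
  -- occurrence of `p` in `r`.
  close-return : ∀ p r → CompleteReturn p r → CompleteReturn (close p) (close r)
  close-return p r ((y , ey) , (x , x≢ , ex) , only) =
    (proj₁ (close-zero y) , trans (cong close ey) (trans (close-++ p y)
      (trans (cong (apply φ p ++_) (proj₂ (close-zero y))) (sym (++-assoc (apply φ p) _ _)))))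
    , (apply φ x , x≢ ∘ apply-[] x , trans (cong close ex) (close-++ x p))
    , inner
    where
    inner : ∀ s t → close r ≡ s ++ close p ++ t → s ≡ [] ⊎ t ≡ []
    inner s t eq
      with z , ez ← close-zero p
      with r₁ , r₂ , e , es , e₂ ← decode-suffix r s (z ++ t) (trans eq (cong (λ y → s ++ y ++ t) ez))
      with r₃ , e₃ , et ← decode-prefix p r₂ t (trans (cong (_++ t) ez) e₂)
      with only r₁ r₃ (trans e (cong (r₁ ++_) e₃))
    ... | inj₁ refl = inj₁ es
    ... | inj₂ refl = inj₂ (∷-injectiveʳ et)

  module _ {v : Word∞ a} {u : Word∞ (suc b)} (cd : Coded φ v u) where

    marker : ∀ i → u (start φ v i) ≡ zero
    marker i = ∷-injectiveˡ (subst (λ x → seg u (start φ v i) (length x) ≡ x) (image (v i)) (cd i))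

    close-coded : ∀ i n → seg u (start φ v i) (length (close (seg v i n))) ≡ close (seg v i n)
    close-coded i n = begin
      seg u s (length (x ++ [ zero ]))        ≡⟨ cong (seg u s) (length-++ x) ⟩
      seg u s (length x + 1)                  ≡⟨ seg-++ u s (length x) 1 ⟩
      seg u s (length x) ++ [ u (length x + s) ]
                                              ≡⟨ cong₂ (λ y z → y ++ [ z ]) (coded-seg cd i n)
                                                   (trans (cong u (sym (start-+ φ v i n))) (marker (n + i))) ⟩
      x ++ [ zero ] ∎
      where
      s = start φ v i
      x = apply φ (seg v i n)

    close-⊑ : ∀ x → x ⊑ v → close x ⊑ u
    close-⊑ x (i , eq) = start φ v i , subst (λ y → seg u (start φ v i) (length (close y)) ≡ close y) eq
      (close-coded i (length x))

    returns-desubstitute : ReturnsPalindromic u → ReturnsPalindromic v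
    returns-desubstitute ret p r r⊑v p≢ pal cr = close-injective (reverse r) r (trans (sym (close-reverse r))
      (ret (close p) (close r) (close-⊑ r r⊑v) (close-≢[] p)
        (trans (close-reverse p) (cong close pal)) (close-return p r cr)))

-- Complete returns in rich words

length-mono : ∀ {A : Set} {xs ys : List A} → Unique xs → xs ⊆ ys → length xs ≤ length ys
length-mono [] _ = z≤n
length-mono {xs = x ∷ xs} {ys} (x∉ ∷ uniq) sub with ∈-∃++ (sub (here refl))
... | as , bs , refl = subst (suc (length xs) ≤_)
  (sym (trans (length-++ as) (trans (+-suc (length as) _) (cong suc (sym (length-++ as))))))
  (s≤s (length-mono uniq rest))
  where
  rest : xs ⊆ as ++ bs
  rest {y} y∈ with ∈-++⁻ as (sub (there y∈))
  ... | inj₁ p = ∈-++⁺ˡ p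
  ... | inj₂ (here refl) = ⊥-elim (All.lookup x∉ y∈ refl)
  ... | inj₂ (there p) = ∈-++⁺ʳ as p

take-length-++ : ∀ {A : Set} (x y : List A) → take (length x) (x ++ y) ≡ x
take-length-++ [] y = refl
take-length-++ (a ∷ x) y = cong (a ∷_) (take-length-++ x y)

prefixes : List (Alph a) → List (List (Alph a))
prefixes x = map (λ n → take (suc n) x) (upTo (length x))

∈-prefixes : ∀ (x : List (Alph a)) y → x ≢ [] → x ∈ prefixes (x ++ y)
∈-prefixes [] y x≢ = ⊥-elim (x≢ refl)
∈-prefixes (c ∷ x) y _ = subst (_∈ prefixes (c ∷ x ++ y)) (cong (c ∷_) (take-length-++ x y))
  (∈-map⁺ (λ n → take (suc n) (c ∷ x ++ y)) (∈-upTo⁺ (s≤s (subst (length x ≤_) (sym (length-++ x)) (m≤m+n _ _)))))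

prefixes⁻ : ∀ (x : List (Alph a)) {q} → q ∈ prefixes x → ∃ λ n → q ≡ take (suc n) x
prefixes⁻ x q∈ with ∈-map⁻ (λ n → take (suc n) x) q∈
... | n , _ , eq = n , eq

∈-nonemptyFactors : ∀ (s x t : List (Alph a)) → x ≢ [] → x ∈ nonemptyFactors (s ++ x ++ t)
∈-nonemptyFactors [] [] t x≢ = ⊥-elim (x≢ refl)
∈-nonemptyFactors [] (c ∷ x) t x≢ = ∈-++⁺ˡ (∈-prefixes (c ∷ x) t x≢)
∈-nonemptyFactors (c ∷ s) x t x≢ = ∈-++⁺ʳ (prefixes (c ∷ s ++ x ++ t)) (∈-nonemptyFactors s x t x≢)

-- Removing the first letter of a rich word loses a palindrome, which is then a prefix occurring only once.
new-palindrome : ∀ c (x : List (Alph a)) → RichFin (c ∷ x) → RichFin x →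
  ∃ λ q → (∃ λ y → c ∷ x ≡ q ++ y) × q ≢ [] × reverse q ≡ q × ¬ (q ∈ nonemptyFactors x)
new-palindrome c x rich′ rich
  with any? (λ q → isPalindrome? q ×-dec ¬? (DecMembership._∈?_ _≟W_ q (nonemptyFactors x))) (prefixes (c ∷ x))
... | yes found with find found
... | q , q∈ , pal , new with prefixes⁻ (c ∷ x) q∈
... | n , refl = take (suc n) (c ∷ x) , (drop (suc n) (c ∷ x) , sym (take++drop≡id (suc n) (c ∷ x))) , (λ ()) , pal , new
new-palindrome c x rich′ rich | no none = ⊥-elim (1+n≰n (subst₂ _≤_ rich′ rich
  (length-mono (Uniqueₚ.deduplicate-! _≟W_ _) sub)))
  where
  sub : palFactors (c ∷ x) ⊆ palFactors x
  sub {q} q∈ with ∈-filter⁻ isPalindrome? (∈-deduplicate⁻ _≟W_ _ q∈)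
  ... | q∈′ , pal = ∈-deduplicate⁺ _≟W_ (∈-filter⁺ isPalindrome? (old (∈-++⁻ (prefixes (c ∷ x)) q∈′)) pal)
    where
    old : q ∈ prefixes (c ∷ x) ⊎ q ∈ nonemptyFactors x → q ∈ nonemptyFactors x
    old (inj₂ p) = p
    old (inj₁ p) = decidable-stable (DecMembership._∈?_ _≟W_ q (nonemptyFactors x))
      λ q∉ → none (Any.map (λ { refl → pal , q∉ }) p)

prefixes-compare : ∀ (p q : List (Alph a)) {y z} → p ++ y ≡ q ++ z →
  (∃ λ p′ → p ≡ q ++ p′) ⊎ (∃ λ q′ → q′ ≢ [] × q ≡ p ++ q′)
prefixes-compare p [] eq = inj₁ (p , refl)
prefixes-compare [] (c ∷ q) eq = inj₂ (c ∷ q , (λ ()) , refl)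
prefixes-compare (c ∷ p) (d ∷ q) eq with prefixes-compare p q (∷-injectiveʳ eq)
... | inj₁ (p′ , e) = inj₁ (p′ , cong₂ _∷_ (∷-injectiveˡ eq) e)
... | inj₂ (q′ , n , e) = inj₂ (q′ , n , cong₂ _∷_ (sym (∷-injectiveˡ eq)) e)

-- Let `q` be the palindromic prefix occurring only once. If `q` were a prefix of `p`, it would
-- occur again where `p` recurs at the end. So `p` is a proper prefix of `q`, and by symmetry `q`
-- ends in `p`; only the last occurrence of `p` is possible there, so `q` is the whole word.
complete-return : ∀ c (x p : List (Alph a)) → RichFin (c ∷ x) → RichFin x → p ≢ [] → reverse p ≡ p →
  CompleteReturn p (c ∷ x) → reverse (c ∷ x) ≡ c ∷ x
complete-return c x p rich′ rich p≢ pal ((y , ey) , (s , s≢ , es) , only)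
  with new-palindrome c x rich′ rich
... | q , (z , ez) , q≢ , palq , new with z
... | [] = trans (cong reverse q≡) (trans palq (sym q≡))
  where
  q≡ : c ∷ x ≡ q
  q≡ = trans ez (++-identityʳ q)
... | d ∷ z′ with prefixes-compare p q (trans (sym ey) ez)
... | inj₁ (p′ , ep) = ⊥-elim (absurd s s≢ es)
  where
  absurd : ∀ s → s ≢ [] → c ∷ x ≡ s ++ p → ⊥
  absurd [] s≢ _ = s≢ refl
  absurd (_ ∷ s) _ es = new (subst (λ w → q ∈ nonemptyFactors w)
    (sym (trans (∷-injectiveʳ es) (cong (s ++_) ep))) (∈-nonemptyFactors s q p′ q≢))
... | inj₂ (q′ , q′≢ , eq) with only (reverse q′) (d ∷ z′)
    (trans ez (trans (cong (_++ d ∷ z′) (trans (sym palq) (trans (cong reverse eq)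
      (trans (reverse-++ p q′) (cong (reverse q′ ++_) pal))))) (++-assoc (reverse q′) p _)))
... | inj₁ e = ⊥-elim (q′≢ (reverse-injective e))

rich⇒returns : ∀ {w : Word∞ a} → Rich w → ReturnsPalindromic w
rich⇒returns {w = w} rich p [] r⊑w p≢ pal cr = refl
rich⇒returns {w = w} rich p (c ∷ x) (i , eq) p≢ pal cr = complete-return c x p
  (subst RichFin (trans (factor≡seg w i (suc (length x))) eq) (rich i (suc (length x))))
  (subst RichFin (trans (factor≡seg w (suc i) (length x)) (∷-injectiveʳ eq)) (rich (suc i) (length x)))
  p≢ pal cr

-- Repetitions

Match : Word∞ b → ℕ → ℕ → ℕ → Set
Match w x y n = ∀ k → k < n → w (k + x) ≡ w (k + y)

MatchBefore : Word∞ b → ℕ → ℕ → ℕ → Set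
MatchBefore w x y n = ∃ λ x′ → ∃ λ y′ → x ≡ n + x′ × y ≡ n + y′ × Match w x′ y′ n

module _ {w : Word∞ b} where

  match-sym : ∀ {x y n} → Match w x y n → Match w y x n
  match-sym m k k<n = sym (m k k<n)

  matchBefore-sym : ∀ {x y n} → MatchBefore w x y n → MatchBefore w y x n
  matchBefore-sym (x′ , y′ , ex , ey , m) = y′ , x′ , ey , ex , match-sym m

  match-zero : ∀ {x y} → Match w x y 0
  match-zero k ()

  match-≤ : ∀ {x y m n} → m ≤ n → Match w x y n → Match w x y m
  match-≤ m≤n match k k<m = match k (<-≤-trans k<m m≤n)

  match-++ : ∀ {x y} m {n} → Match w x y m → Match w (m + x) (m + y) n → Match w x y (m + n)
  match-++ zero p q = q
  match-++ {x} {y} (suc m) p q zero _ = p 0 (s≤s z≤n)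
  match-++ {x} {y} (suc m) {n} p q (suc k) (s≤s k<) =
    subst₂ (λ i j → w i ≡ w j) (+-suc k x) (+-suc k y)
      (match-++ {suc x} {suc y} m {n}
        (λ k k<m → subst₂ (λ i j → w i ≡ w j) (sym (+-suc k x)) (sym (+-suc k y)) (p (suc k) (s≤s k<m)))
        (subst₂ (λ i j → Match w i j n) (sym (+-suc m x)) (sym (+-suc m y)) q) k k<)

  matchBefore-++ : ∀ {x y} m {n} → Match w x y m → MatchBefore w x y n →
    MatchBefore w (m + x) (m + y) (m + n)
  matchBefore-++ m {n} p (x′ , y′ , refl , refl , q) =
    x′ , y′ , sym (+-assoc m n x′) , sym (+-assoc m n y′) ,
    subst (Match w x′ y′) (+-comm n m) (match-++ n q p)

  -- Agreement of length `n` at distance `p` gives a factor of length `p + n` with period `p`.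
  no-repetition : Free 14 5 w → ∀ i p n → 1 ≤ p → 14 * p ≤ 5 * (p + n) → ¬ Match w i (p + i) n
  no-repetition free i p n 1≤p big m = free (i , p + n , p , ≤-trans 1≤p (m≤m+n p n) , 1≤p , big ,
    λ j lt → trans (cong w (+-comm i j)) (trans (m j (+-cancelˡ-< p j n (subst (_< p + n) (+-comm j p) lt)))
      (cong w (trans (cong (j +_) (+-comm p i)) (trans (sym (+-assoc j i p)) (cong (_+ p) (+-comm j i)))))))

weight : (Alph a → ℕ) → List (Alph a) → ℕ
weight size [] = 0
weight size (x ∷ xs) = size x + weight size xs

-- An agreement in `w` guaranteed by two coding words: equal letters contribute their block lengths,
-- the first disagreement contributes `ext`, and the end of either word contributes 0, as nothing is
-- known beyond it.
common : (Alph a → ℕ) → (Alph a → Alph a → ℕ) → List (Alph a) → List (Alph a) → ℕ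
common size ext [] y = 0
common size ext (c ∷ x) [] = 0
common size ext (c ∷ x) (d ∷ y) = if does (c ≟F d) then size c + common size ext x y else ext c d

-- u is read off w in blocks: size gives their lengths, fwd (bwd) a length over which the
-- continuations (the pasts) of blocks coding two different letters agree.
record Level (size : Alph a → ℕ) (fwd bwd : Alph a → Alph a → ℕ) (w : Word∞ b) (u : Word∞ a) : Set where
  field
    pos : ℕ → ℕ
    step : ∀ i → pos (suc i) ≡ size (u i) + pos i
    same : ∀ i j → u i ≡ u j → Match w (pos i) (pos j) (size (u i))
    ahead : ∀ i j → u i ≢ u j → Match w (pos i) (pos j) (fwd (u i) (u j))
    behind : ∀ i j → u i ≢ u j → MatchBefore w (pos (suc i)) (pos (suc j)) (bwd (u i) (u j))

  pos-seg : ∀ i n → pos (n + i) ≡ weight size (seg u i n) + pos i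
  pos-seg i zero = refl
  pos-seg i (suc n) = begin
    pos (suc (n + i))                    ≡⟨ cong pos (sym (+-suc n i)) ⟩
    pos (n + suc i)                      ≡⟨ pos-seg (suc i) n ⟩
    weight size (seg u (suc i) n) + pos (suc i)
                                         ≡⟨ cong (weight size (seg u (suc i) n) +_) (step i) ⟩
    weight size (seg u (suc i) n) + (size (u i) + pos i)
                                         ≡⟨ sym (+-assoc _ (size (u i)) (pos i)) ⟩
    (weight size (seg u (suc i) n) + size (u i)) + pos i
                                         ≡⟨ cong (_+ pos i) (+-comm _ (size (u i))) ⟩
    weight size (seg u i (suc n)) + pos i ∎

  match-seg : ∀ i j n → seg u i n ≡ seg u j n → Match w (pos i) (pos j) (weight size (seg u i n))
  match-seg i j zero eq = match-zero {w = w}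
  match-seg i j (suc n) eq = match-++ {w = w} (size (u i)) (same i j e)
    (subst₂ (λ x y → Match w x y (weight size (seg u (suc i) n))) (step i)
      (trans (step j) (cong (λ x → size x + pos j) (sym e))) (match-seg (suc i) (suc j) n (∷-injectiveʳ eq)))
    where e = ∷-injectiveˡ eq

  match-common : ∀ i j x y → seg u i (length x) ≡ x → seg u j (length y) ≡ y →
    Match w (pos i) (pos j) (common size fwd x y)
  match-common i j [] y ex ey = match-zero {w = w}
  match-common i j (c ∷ x) [] ex ey = match-zero {w = w}
  match-common i j (c ∷ x) (d ∷ y) ex ey with c ≟F d
  ... | no c≢d = subst₂ (λ c d → Match w (pos i) (pos j) (fwd c d)) ec ed
      (ahead i j λ e → c≢d (trans (sym ec) (trans e ed)))
    where ec = ∷-injectiveˡ ex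
          ed = ∷-injectiveˡ ey
  ... | yes refl = match-++ {w = w} (size c) (subst (λ x → Match w (pos i) (pos j) (size x)) ec (same i j (trans ec (sym ed))))
      (subst₂ (λ p q → Match w p q (common size fwd x y)) (trans (step i) (cong (λ x → size x + pos i) ec))
        (trans (step j) (cong (λ x → size x + pos j) ed))
        (match-common (suc i) (suc j) x y (∷-injectiveʳ ex) (∷-injectiveʳ ey)))
    where ec = ∷-injectiveˡ ex
          ed = ∷-injectiveˡ ey

  matchBefore-common : ∀ i j x y → back u i (length x) ≡ x → back u j (length y) ≡ y →
    MatchBefore w (pos (length x + i)) (pos (length y + j)) (common size bwd x y)
  matchBefore-common i j [] y ex ey = _ , _ , refl , refl , match-zero {w = w}
  matchBefore-common i j (c ∷ x) [] ex ey = _ , _ , refl , refl , match-zero {w = w}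
  matchBefore-common i j (c ∷ x) (d ∷ y) ex ey with c ≟F d
  ... | no c≢d = subst₂ (λ c d → MatchBefore w (pos (suc i′)) (pos (suc j′)) (bwd c d)) ec ed
      (behind i′ j′ λ e → c≢d (trans (sym ec) (trans e ed)))
    where i′ = length x + i
          j′ = length y + j
          ec = ∷-injectiveˡ ex
          ed = ∷-injectiveˡ ey
  ... | yes refl = subst₂ (λ p q → MatchBefore w p q (size c + common size bwd x y))
      (sym (trans (step i′) (cong (λ x → size x + pos i′) ec)))
      (sym (trans (step j′) (cong (λ x → size x + pos j′) ed)))
      (matchBefore-++ {w = w} (size c) (subst (λ x → Match w (pos i′) (pos j′) (size x)) ec (same i′ j′ (trans ec (sym ed))))
        (matchBefore-common i j x y (∷-injectiveʳ ex) (∷-injectiveʳ ey)))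
    where i′ = length x + i
          j′ = length y + j
          ec = ∷-injectiveˡ ex
          ed = ∷-injectiveˡ ey

level-letters : ∀ (w : Word∞ b) → Level (const 1) (λ _ _ → 0) (λ _ _ → 0) w w
level-letters w = record
  { pos = id
  ; step = λ _ → refl
  ; same = λ { i j eq zero _ → eq ; i j eq (suc _) (s≤s ()) }
  ; ahead = λ _ _ _ → match-zero {w = w}
  ; behind = λ i j _ → suc i , suc j , refl , refl , match-zero {w = w}
  }

level-suffix : ∀ {size : Alph a → ℕ} {fwd bwd} {w : Word∞ b} {u} → Level size fwd bwd w u →
  ∀ i → Level size fwd bwd w (suffix u i)
level-suffix {w = w} {u} L i = record
  { pos = λ j → pos (i + j)
  ; step = λ j → trans (cong pos (+-suc i j)) (step (i + j))
  ; same = λ j k → same (i + j) (i + k)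
  ; ahead = λ j k → ahead (i + j) (i + k)
  ; behind = λ j k ne → subst₂ (λ x y → MatchBefore w x y _) (cong pos (sym (+-suc i j))) (cong pos (sym (+-suc i k)))
      (behind (i + j) (i + k) ne)
  }
  where open Level L

module Desubstituted (φ : Morphism a (suc b)) (size : Alph (suc b) → ℕ) (fwd bwd : Alph (suc b) → Alph (suc b) → ℕ) where

  size′ : Alph a → ℕ
  size′ x = weight size (φ x)

  -- Forwards, the marker of the next block is known in advance and is appended. Backwards, the
  -- blocks are compared from their ends. In both directions the first disagreement is prolonged by
  -- the bound of the previous level.
  fwd′ bwd′ : Alph a → Alph a → ℕ
  fwd′ x y = common size fwd (φ x ++ [ zero ]) (φ y ++ [ zero ])
  bwd′ x y = common size bwd (reverse (φ x)) (reverse (φ y))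

  level : Marked φ → ∀ {w : Word∞ c} {u v} → Coded φ v u → Level size fwd bwd w u → Level size′ fwd′ bwd′ w v
  level marked {w} {u} {v} cd L = record
    { pos = pos′
    ; step = λ i → trans (pos-seg (start φ v i) (length (φ (v i)))) (cong (λ x → weight size x + pos′ i) (cd i))
    ; same = λ i j eq → subst (λ x → Match w (pos′ i) (pos′ j) (weight size x)) (cd i)
        (match-seg (start φ v i) (start φ v j) (length (φ (v i)))
          (trans (cd i) (trans (cong φ eq) (sym (subst (λ x → seg u (start φ v j) (length (φ x)) ≡ φ (v j)) (sym eq) (cd j))))))
    ; ahead = λ i j _ → match-common (start φ v i) (start φ v j) _ _ (closed i) (closed j)
    ; behind = λ i j _ → subst₂ (λ m n → MatchBefore w (pos m) (pos n) (bwd′ (v i) (v j))) (end i) (end j)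
        (matchBefore-common (start φ v i) (start φ v j) _ _ (reversed i) (reversed j))
    }
    where
    open Level L
    open MarkedMorphism marked
    pos′ : ℕ → ℕ
    pos′ i = pos (start φ v i)
    closed : ∀ i → seg u (start φ v i) (length (φ (v i) ++ [ zero ])) ≡ φ (v i) ++ [ zero ]
    closed i = subst (λ x → seg u (start φ v i) (length (x ++ [ zero ])) ≡ x ++ [ zero ]) (++-identityʳ (φ (v i)))
      (close-coded cd i 1)
    reversed : ∀ i → back u (start φ v i) (length (reverse (φ (v i)))) ≡ reverse (φ (v i))
    reversed i = trans (back≡reverse u (start φ v i) _) (cong reverse
      (trans (cong (seg u (start φ v i)) (length-reverse (φ (v i)))) (cd i)))
    end : ∀ i → length (reverse (φ (v i))) + start φ v i ≡ start φ v (suc i)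
    end i = cong (_+ start φ v i) (length-reverse (φ (v i)))

-- The first two codings

Avoids-desubstitute : ∀ {φ : Morphism a (suc b)} (marked : Marked φ) {v u} → Coded φ v u →
  ∀ x → Avoids (apply φ x ++ [ zero ]) u → Avoids x v
Avoids-desubstitute marked cd x av i eq with MarkedMorphism.close-⊑ marked cd x (i , eq)
... | j , eq′ = av j eq′

seg-drop : ∀ (w : Word∞ a) i n x → seg w i (length x) ≡ x → seg w (n + i) (length (drop n x)) ≡ drop n x
seg-drop w i zero x eq = eq
seg-drop w i (suc n) [] eq = refl
seg-drop w i (suc n) (c ∷ x) eq = subst (λ j → seg w j (length (drop n x)) ≡ drop n x) (+-suc n i)
  (seg-drop w (suc i) n x (∷-injectiveʳ eq))

seg-beginsWith : ∀ (w : Word∞ a) i n x → BeginsWith (seg w i n) x → seg w i (length x) ≡ x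
seg-beginsWith w i n x (z , eq) = proj₁ (seg-split w i x z (trans (cong (seg w i)
  (trans (cong length (sym eq)) (length-seg w i n))) eq))

-- `p` plus the length common to `x` and `drop p x` is the length of the longest prefix of `x` with
-- period `p`.
repeatsAt : List (Alph a) → ℕ → Bool
repeatsAt x p = 14 * p ≤ᵇ 5 * (p + common (const 1) (λ _ _ → 0) x (drop p x))

repeats : List (Alph a) → Bool
repeats [] = false
repeats (c ∷ x) = any (λ p → repeatsAt (c ∷ x) (suc p)) (upTo (length x)) ∨ repeats x

excluded : List (Alph a) → Bool
excluded x = repeats x ∨ isNo (length (palFactors x) ≟ length x)

module _ {w : Word∞ a} (rich : Rich w) (free : Free 14 5 w) where

  repeats-avoided : ∀ x → T (repeats x) → Avoids x w
  repeats-avoided (c ∷ x) t i eq with Equivalence.to T-∨ t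
  ... | inj₂ t′ = repeats-avoided x t′ (suc i) (∷-injectiveʳ eq)
  ... | inj₁ t′ with satisfied (Anyₚ.any⁻ (λ p → repeatsAt (c ∷ x) (suc p)) (upTo (length x)) t′)
  ... | p , big = no-repetition {w = w} free i (suc p) _ (s≤s z≤n) (≤ᵇ⇒≤ _ _ big)
    (Level.match-common (level-letters w) i (suc p + i) (c ∷ x) (drop p x) eq (seg-drop w i (suc p) (c ∷ x) eq))

  excluded-avoided : ∀ x → T (excluded x) → Avoids x w
  excluded-avoided x t i eq with Equivalence.to T-∨ t
  ... | inj₁ t′ = repeats-avoided x t′ i eq
  ... | inj₂ t′ = toWitnessFalse t′ (subst RichFin (trans (factor≡seg w i (length x)) eq) (rich i (length x)))

onMarker : (List (Alph (suc b)) → Bool) → List (Alph (suc b)) → Bool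
onMarker goal z@(zero ∷ _) = goal z
onMarker goal _ = true

isMarker : Alph (suc b) → Bool
isMarker zero = true
isMarker _ = false

block : Morphism a (suc b) → List (Alph (suc b)) → Bool
block {a} φ z = any (λ x → prefixOf (φ x ++ [ zero ]) z) (allFin a)

twoBlocks : Morphism a (suc b) → List (Alph (suc b)) → Bool
twoBlocks {a} φ z = any (λ x → any (λ y → prefixOf (φ x ++ φ y ++ [ zero ]) z) (allFin a)) (allFin a)

BlockAt : Morphism a (suc b) → Word∞ (suc b) → ℕ → Set
BlockAt φ u i = ∃ λ x → seg u i (length (φ x ++ [ zero ])) ≡ φ x ++ [ zero ]

TwoBlocksAt : Morphism a (suc b) → Word∞ (suc b) → ℕ → Set
TwoBlocksAt φ u i = ∃ λ x → seg u i (length (φ x)) ≡ φ x × BlockAt φ u (length (φ x) + i)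

module _ (u : Word∞ (suc b)) where

  onMarker-sound : ∀ goal i n → T (onMarker goal (seg u i (suc n))) → u i ≡ zero → T (goal (seg u i (suc n)))
  onMarker-sound goal i n t eq with u i
  onMarker-sound goal i n t refl | zero = t

  marker-sound : ∀ i n → T (any isMarker (seg u i n)) → ∃ λ j → u j ≡ zero
  marker-sound i (suc n) t with u i in eq
  ... | zero = i , eq
  ... | suc _ = marker-sound (suc i) n t

  block-sound : ∀ (φ : Morphism a (suc b)) i n → T (block φ (seg u i n)) → BlockAt φ u i
  block-sound φ i n t with satisfied (Anyₚ.any⁻ (λ x → prefixOf (φ x ++ [ zero ]) (seg u i n)) (allFin _) t)
  ... | x , t′ = x , seg-beginsWith u i n (φ x ++ [ zero ]) (prefixOf-sound (φ x ++ [ zero ]) _ t′)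

  twoBlocks-sound : ∀ (φ : Morphism a (suc b)) i n → T (twoBlocks φ (seg u i n)) → TwoBlocksAt φ u i
  twoBlocks-sound φ i n t
    with satisfied (Anyₚ.any⁻ (λ x → any (λ y → prefixOf (φ x ++ φ y ++ [ zero ]) (seg u i n)) (allFin _)) (allFin _) t)
  ... | x , t₁ with satisfied (Anyₚ.any⁻ (λ y → prefixOf (φ x ++ φ y ++ [ zero ]) (seg u i n)) (allFin _) t₁)
  ... | y , t₂ with seg-split u i (φ x) (φ y ++ [ zero ])
    (seg-beginsWith u i n (φ x ++ φ y ++ [ zero ]) (prefixOf-sound (φ x ++ φ y ++ [ zero ]) _ t₂))
  ... | e , e′ = x , e , y , e′

  parse : ∀ (φ : Morphism a (suc b)) → (∀ i → u i ≡ zero → BlockAt φ u i) →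
    ∀ i → u i ≡ zero → ∃ λ v → Coded φ v (suffix u i)
  parse φ blocks = desubstitute φ u (λ i → u i ≡ zero) λ i eq → let x , e = blocks i eq
                                                                    e₁ , e₂ = seg-split u i (φ x) [ zero ] e
    in x , e₁ , ∷-injectiveˡ e₂

  block-marker : ∀ {φ : Morphism a (suc b)} → Marked φ → ∀ i → BlockAt φ u i → u i ≡ zero
  block-marker marked i (x , e) = ∷-injectiveˡ
    (subst (λ y → seg u i (length (y ++ [ zero ])) ≡ y ++ [ zero ]) (Marked.image marked x) e)

  first-block : ∀ {φ : Morphism a (suc b)} → Marked φ → ∀ i → TwoBlocksAt φ u i → BlockAt φ u i
  first-block {φ = φ} marked i (x , e , at) = x , trans (cong (seg u i) (length-++ (φ x)))
    (trans (seg-++ u i (length (φ x)) 1) (cong₂ (λ p q → p ++ [ q ]) e (block-marker marked _ at)))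

  -- The invariant is that a block of `φ` starts here. Each marker is followed by two blocks of one
  -- and the same morphism; those of `ψ` are ruled out by the clash at the first block, so the next
  -- block is again one of `φ`.
  parse-alternative : ∀ {φ : Morphism a (suc b)} {ψ : Morphism c (suc b)} → Marked φ → Marked ψ →
    (∀ i → BlockAt φ u i → ¬ BlockAt ψ u i) →
    (∀ i → u i ≡ zero → TwoBlocksAt φ u i ⊎ TwoBlocksAt ψ u i) →
    ∀ i → BlockAt φ u i → ∃ λ v → Coded φ v (suffix u i)
  parse-alternative {φ = φ} {ψ} mφ mψ clash blocks = desubstitute φ u (BlockAt φ u) step
    where
    step : ∀ i → BlockAt φ u i → ∃ λ x → seg u i (length (φ x)) ≡ φ x × BlockAt φ u (length (φ x) + i)
    step i at with blocks i (block-marker mφ i at)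
    ... | inj₁ two = two
    ... | inj₂ two = ⊥-elim (clash i at (first-block mψ i two))

f-marked : Marked f
f-marked = record
  { tail = λ { zero → [] ; (suc zero) → 1₂ ∷ [] ; (suc (suc zero)) → 1₂ ∷ 1₂ ∷ [] }
  ; image = λ { zero → refl ; (suc zero) → refl ; (suc (suc zero)) → refl }
  ; free = λ { zero → [] ; (suc zero) → (λ ()) ∷ [] ; (suc (suc zero)) → (λ ()) ∷ (λ ()) ∷ [] }
  ; injective = λ { zero zero _ → refl ; zero (suc zero) () ; zero (suc (suc zero)) ()
                  ; (suc zero) zero () ; (suc zero) (suc zero) _ → refl ; (suc zero) (suc (suc zero)) ()
                  ; (suc (suc zero)) zero () ; (suc (suc zero)) (suc zero) () ; (suc (suc zero)) (suc (suc zero)) _ → refl }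
  ; palindrome = λ { zero → refl ; (suc zero) → refl ; (suc (suc zero)) → refl }
  }

g-marked : Marked g
g-marked = record
  { tail = λ { zero → 1₃ ∷ 1₃ ∷ [] ; (suc zero) → 1₃ ∷ 2₃ ∷ 1₃ ∷ [] ; (suc (suc zero)) → 1₃ ∷ 2₃ ∷ 1₃ ∷ 2₃ ∷ 1₃ ∷ [] }
  ; image = λ { zero → refl ; (suc zero) → refl ; (suc (suc zero)) → refl }
  ; free = λ { zero → (λ ()) ∷ (λ ()) ∷ [] ; (suc zero) → (λ ()) ∷ (λ ()) ∷ (λ ()) ∷ [] ; (suc (suc zero)) → (λ ()) ∷ (λ ()) ∷ (λ ()) ∷ (λ ()) ∷ (λ ()) ∷ [] }
  ; injective = λ { zero zero _ → refl ; zero (suc zero) () ; zero (suc (suc zero)) ()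
                  ; (suc zero) zero () ; (suc zero) (suc zero) _ → refl ; (suc zero) (suc (suc zero)) ()
                  ; (suc (suc zero)) zero () ; (suc (suc zero)) (suc zero) () ; (suc (suc zero)) (suc (suc zero)) _ → refl }
  ; palindrome = λ { zero → refl ; (suc zero) → refl ; (suc (suc zero)) → refl }
  }

h-marked : Marked h
h-marked = record
  { tail = λ { zero → 1₃ ∷ [] ; (suc zero) → 2₃ ∷ [] ; (suc (suc zero)) → 2₃ ∷ 2₃ ∷ [] }
  ; image = λ { zero → refl ; (suc zero) → refl ; (suc (suc zero)) → refl }
  ; free = λ { zero → (λ ()) ∷ [] ; (suc zero) → (λ ()) ∷ [] ; (suc (suc zero)) → (λ ()) ∷ (λ ()) ∷ [] }
  ; injective = λ { zero zero _ → refl ; zero (suc zero) () ; zero (suc (suc zero)) ()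
                  ; (suc zero) zero () ; (suc zero) (suc zero) _ → refl ; (suc zero) (suc (suc zero)) ()
                  ; (suc (suc zero)) zero () ; (suc (suc zero)) (suc zero) () ; (suc (suc zero)) (suc (suc zero)) _ → refl }
  ; palindrome = λ { zero → refl ; (suc zero) → refl ; (suc (suc zero)) → refl }
  }

first-coding : ∀ {w : Word∞ 2} → Rich w → Free 14 5 w → ∃ λ i → ∃ λ u → Coded f u (suffix w i)
first-coding {w} rich free = let j , eq = marker-sound w 0 3 (unavoidable-sound no111 3 0 (any isMarker) tt avoided 0)
  in j , parse w f (λ i eq → block-sound w f i 4 (onMarker-sound w (block f) i 3
    (unavoidable-sound no111 4 0 (onMarker (block f)) tt avoided i) eq)) j eq
  where
  -- `111` has exponent 3. Without it every `0` starts one of `00`, `010`, `0110`, the blocks of `f`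
  -- with their closing marker, which fit into 4 letters.
  no111 : List (List (Alph 2))
  no111 = (1₂ ∷ 1₂ ∷ 1₂ ∷ []) ∷ []
  avoided : All (λ x → Avoids x w) no111
  avoided = excluded-avoided rich free _ tt ∷ []

-- 48 is the character code of the digit 0; the default case reads the digit 2.
letter : Char → Alph 3
letter c with toℕ c ∸ 48
... | 0 = 0₃
... | 1 = 1₃
... | _ = 2₃

ternary : String → List (List (Alph 3))
ternary s = map (map letter ∘ toList) (words s)

-- Words x for which f(x)0 is not rich or contains a repetition of exponent at least 14/5, selected by
-- computer so that second-coding's search succeeds.
forbidden : List (List (Alph 3))
forbidden = ternary
  ("00 111 112 211 222 0120 0210 1021 1201 1221 2012 2102 01220 02210 10101 10221 11022 12201 "
  ++ˢ "20202 21212 22011 010102 012120 021210 021220 022120 102021 120201 120221 122021 201010 201012 "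
  ++ˢ "210102 0121220 0221210 1020201 1022021 1101022 1102022 1202201 1220201 2011012 2101102 "
  ++ˢ "01101101 10110110 12202201 20101102 20110102 22022022 110102011 110102022 110201011 110201022 "
  ++ˢ "120220201 120220220 120220221 122022021 201011012 201101102 1220220201 10201020102 11010201022 "
  ++ˢ "11020102022 20212021202 101020102010 1101020102011 1101020102022 1102010201011 10201102011020 "
  ++ˢ "2212202212202212 2202120220212022021 201011010201011010201011 201102010201102010201102")

forbidden-avoided : ∀ {w : Word∞ 2} → Rich w → Free 14 5 w → ∀ {i u} → Coded f u (suffix w i) →
  All (λ x → Avoids x u) forbidden
forbidden-avoided {w} rich free {i} {u} cd = All.map
  (λ {x} t → Avoids-desubstitute f-marked cd x (Avoids-suffix {w = w} i (excluded-avoided rich free _ t)))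
  (Allₚ.all⁺ (λ x → excluded (apply f x ++ [ zero ])) forbidden tt)

blocks-of-h-or-g : List (Alph 3) → Bool
blocks-of-h-or-g = onMarker λ z → twoBlocks h z ∨ twoBlocks g z

-- Three letters decide: closed blocks of `h` start with `010`, `020` or `022`, those of `g` with
-- `011` or `012`.
h-g-clash : ∀ (u : Word∞ 3) i → BlockAt h u i → ¬ BlockAt g u i
h-g-clash u i (x , e) (y , e′) = clash x y e e′
  where
  clash : ∀ x y → seg u i (length (h x ++ [ zero ])) ≡ h x ++ [ zero ] →
    seg u i (length (g y ++ [ zero ])) ≢ g y ++ [ zero ]
  clash zero zero e e′ with () ← trans (sym (cong (take 3) e)) (cong (take 3) e′)
  clash zero (suc zero) e e′ with () ← trans (sym (cong (take 3) e)) (cong (take 3) e′)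
  clash zero (suc (suc zero)) e e′ with () ← trans (sym (cong (take 3) e)) (cong (take 3) e′)
  clash (suc zero) zero e e′ with () ← trans (sym (cong (take 3) e)) (cong (take 3) e′)
  clash (suc zero) (suc zero) e e′ with () ← trans (sym (cong (take 3) e)) (cong (take 3) e′)
  clash (suc zero) (suc (suc zero)) e e′ with () ← trans (sym (cong (take 3) e)) (cong (take 3) e′)
  clash (suc (suc zero)) zero e e′ with () ← trans (sym (cong (take 3) e)) (cong (take 3) e′)
  clash (suc (suc zero)) (suc zero) e e′ with () ← trans (sym (cong (take 3) e)) (cong (take 3) e′)
  clash (suc (suc zero)) (suc (suc zero)) e e′ with () ← trans (sym (cong (take 3) e)) (cong (take 3) e′)

second-coding : ∀ {u : Word∞ 3} → All (λ x → Avoids x u) forbidden →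
  (∃ λ i → ∃ λ v → Coded h v (suffix u i)) ⊎ (∃ λ i → ∃ λ v → Coded g v (suffix u i))
second-coding {u} avoided = let j , eq = marker-sound u′ 0 7 (unavoidable-sound forbidden 7 22 (any isMarker) tt shifted 0)
  in Sum.map
    (λ two → 2 + j , parse-alternative u′ h-marked g-marked (h-g-clash u′) blocks j (first-block u′ h-marked j two))
    (λ two → 2 + j , parse-alternative u′ g-marked h-marked (λ i p q → h-g-clash u′ i q p)
      (λ i eq → Sum.swap (blocks i eq)) j (first-block u′ g-marked j two))
    (blocks j eq)
  where
  -- The search fails without two letters of left context.
  u′ : Word∞ 3
  u′ = suffix u 2
  shifted : All (λ x → Avoids x u′) forbidden
  shifted = All.map (Avoids-suffix {w = u} 2) avoided
  blocks : ∀ i → u′ i ≡ zero → TwoBlocksAt h u′ i ⊎ TwoBlocksAt g u′ i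
  -- Two longest blocks of `g` and the closing marker take 6 + 6 + 1 = 13 letters; the left context
  -- adds two, hence the window of 15.
  blocks i eq = Sum.map (twoBlocks-sound u′ h i 13) (twoBlocks-sound u′ g i 13)
    (Equivalence.to T-∨ (onMarker-sound u′ (λ z → twoBlocks h z ∨ twoBlocks g z) i 12
      (subst (T ∘ blocks-of-h-or-g) (sym (seg-suffix u 2 i 13))
        (unavoidable-sound forbidden 15 22 (blocks-of-h-or-g ∘ drop 2) tt avoided i)) eq))

-- Coding by h

-- The word `c m c` is a complete return to the palindrome `c`, because `m` contains no `c`; its
-- being a palindrome would make `m` one.
letter-return : ∀ {u : Word∞ a} → ReturnsPalindromic u → ∀ c m → All (c ≢_) m → reverse m ≢ m →
  Avoids (c ∷ m ++ [ c ]) u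
letter-return {u = u} ret c m free nonpal i eq = nonpal (++-cancelʳ [ c ] (reverse m) m (∷-injectiveʳ (begin
  c ∷ reverse m ++ [ c ]       ≡⟨ cong (_++ [ c ]) (sym (reverse-++ m [ c ])) ⟩
  reverse (m ++ [ c ]) ++ [ c ] ≡⟨ sym (unfold-reverse c (m ++ [ c ])) ⟩
  reverse (c ∷ m ++ [ c ])     ≡⟨ ret [ c ] (c ∷ m ++ [ c ]) (i , eq) (λ ()) refl
                                    ((m ++ [ c ] , refl) , (c ∷ m , (λ ()) , refl) , only) ⟩
  c ∷ m ++ [ c ] ∎)))
  where
  last : ∀ m → All (c ≢_) m → ∀ s t → m ++ [ c ] ≡ s ++ c ∷ t → t ≡ []
  last [] [] [] t eq = sym (∷-injectiveʳ eq)
  last [] [] (_ ∷ []) t ()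
  last [] [] (_ ∷ _ ∷ _) t ()
  last (x ∷ m) (n ∷ _) [] t eq = ⊥-elim (n (sym (∷-injectiveˡ eq)))
  last (x ∷ m) (_ ∷ f) (_ ∷ s) t eq = last m f s t (∷-injectiveʳ eq)
  only : ∀ s t → c ∷ m ++ [ c ] ≡ s ++ [ c ] ++ t → s ≡ [] ⊎ t ≡ []
  only [] t eq = inj₁ refl
  only (_ ∷ s) t eq = inj₂ (last m free s t (∷-injectiveʳ eq))

-- A, B, C are the lengths of the images of the letters; c, e (d, δ) are the lengths of the common
-- continuation (past) of the images of 0 and another letter, and of 1 and 2.
record Bounds (A B C c e d δ : ℕ) : Set where
  field
    A≥1 : 1 ≤ A
    B≥1 : 1 ≤ B
    C≥1 : 1 ≤ C
    c≤e : c ≤ e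
    e≤C+c : e ≤ C + c
    C≤A+B : C ≤ A + B
    4A≤ : 4 * A ≤ 5 * c
    4B≤ : 4 * B ≤ 5 * (c + d)
    4B≤′ : 4 * B ≤ 5 * (c + δ)
    4C≤ : 4 * C ≤ 5 * (c + δ)
    9B≤ : 9 * B ≤ 5 * (δ + e)
    4B≤″ : 4 * B ≤ A + 5 * e
    3C≤ : 3 * C ≤ A + 5 * (e + d)
    3B≤ : 3 * B ≤ A + C + 5 * c

-- y − x = (r − l) + s, with both sides moved so that no subtraction occurs.
by-slack : ∀ {l r x y} s → l ≤ r → x + r + s ≡ y + l → x ≤ y
by-slack {l} {r} {x} {y} s l≤r eq = +-cancelʳ-≤ r x y
  (≤-trans (m≤m+n (x + r) s) (≤-trans (≤-reflexive eq) (+-monoʳ-≤ y l≤r)))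

-- The new lengths come from comparing `01`, `02` and `022`: for instance `01` first differs from
-- the others in 1 against 2, after a common 0, so `c` becomes `A + e`. The inequalities `e≤C+c`,
-- `C≤A+B`, `4B≤″` and `3C≤` are there to carry the others to the next level.
bounds-h : ∀ {A B C c e d δ} → Bounds A B C c e d δ →
  Bounds (A + (B + 0)) (A + (C + 0)) (A + (C + (C + 0))) (A + e) (A + (C + c)) δ (C + d)
bounds-h {A} {B} {C} {c} {e} {d} {δ} bd = record
  { A≥1 = ≤-trans A≥1 (m≤m+n A _)
  ; B≥1 = ≤-trans A≥1 (m≤m+n A _)
  ; C≥1 = ≤-trans A≥1 (m≤m+n A _)
  ; c≤e = +-monoʳ-≤ A e≤C+c
  ; e≤C+c = by-slack (A + C) c≤e (s1 A C c e)
  ; C≤A+B = by-slack 0 C≤A+B (s2 A B C)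
  ; 4A≤ = by-slack 0 4B≤″ (s3 A B e)
  ; 4B≤ = by-slack A (+-mono-≤ 4C≤ (*-monoʳ-≤ 5 c≤e)) (s4 A C c e δ)
  ; 4B≤′ = by-slack (A + C + 5 * (e + d)) (z≤n {0}) (s5 A C e d)
  ; 4C≤ = by-slack 0 3C≤ (s6 A C e d)
  ; 9B≤ = by-slack (C + 5 * d) 4A≤ (s7 A C c d)
  ; 4B≤″ = by-slack (2 * A + B + C + 5 * c) (z≤n {0}) (s8 A B C c)
  ; 3C≤ = by-slack (3 * A + B + 3 * C) 4C≤ (s9 A B C c δ)
  ; 3B≤ = by-slack (3 * A + 5 * e) C≤A+B (s10 A B C e)
  }
  where
  open Bounds bd
  s1 : ∀ A C c e → A + (C + c) + e + (A + C) ≡ A + (C + (C + 0)) + (A + e) + c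
  s1 = solve-∀
  s2 : ∀ A B C → A + (C + (C + 0)) + (A + B) + 0 ≡ A + (B + 0) + (A + (C + 0)) + C
  s2 = solve-∀
  s3 : ∀ A B e → 4 * (A + (B + 0)) + (A + 5 * e) + 0 ≡ 5 * (A + e) + 4 * B
  s3 = solve-∀
  s4 : ∀ A C c e δ → 4 * (A + (C + 0)) + (5 * (c + δ) + 5 * e) + A ≡ 5 * (A + e + δ) + (4 * C + 5 * c)
  s4 = solve-∀
  s5 : ∀ A C e d → 4 * (A + (C + 0)) + 0 + (A + C + 5 * (e + d)) ≡ 5 * (A + e + (C + d)) + 0
  s5 = solve-∀
  s6 : ∀ A C e d → 4 * (A + (C + (C + 0))) + (A + 5 * (e + d)) + 0 ≡ 5 * (A + e + (C + d)) + 3 * C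
  s6 = solve-∀
  s7 : ∀ A C c d → 9 * (A + (C + 0)) + 5 * c + (C + 5 * d) ≡ 5 * (C + d + (A + (C + c))) + 4 * A
  s7 = solve-∀
  s8 : ∀ A B C c → 4 * (A + (C + 0)) + 0 + (2 * A + B + C + 5 * c) ≡ A + (B + 0) + 5 * (A + (C + c)) + 0
  s8 = solve-∀
  s9 : ∀ A B C c δ → 3 * (A + (C + (C + 0))) + 5 * (c + δ) + (3 * A + B + 3 * C) ≡
    A + (B + 0) + 5 * (A + (C + c) + δ) + 4 * C
  s9 = solve-∀
  s10 : ∀ A B C e → 3 * (A + (C + 0)) + (A + B) + (3 * A + 5 * e) ≡
    A + (B + 0) + (A + (C + (C + 0))) + 5 * (A + e) + C
  s10 = solve-∀

-- The letters 1 and 2 compare alike with 0, which is why one `c` and one `d` suffice in `Bounds`.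
record Admissible (size : Alph 3 → ℕ) (fwd bwd : Alph 3 → Alph 3 → ℕ) : Set where
  field
    fwd≡ : fwd 0₃ 1₃ ≡ fwd 0₃ 2₃
    bwd≡ : bwd 0₃ 1₃ ≡ bwd 0₃ 2₃
    bounds : Bounds (size 0₃) (size 1₃) (size 2₃) (fwd 0₃ 2₃) (fwd 1₃ 2₃) (bwd 0₃ 2₃) (bwd 1₃ 2₃)

-- The first nine words force repetitions of exponent at least 14/5 in `w`; the last three are
-- non-palindromic complete returns to a letter.
forbidden-h : List (List (Alph 3))
forbidden-h = ternary "00 011 111 122 211 212 222 10101 21012101210 0120 2102 210102"

module _ {w : Word∞ b} (free : Free 14 5 w) {u : Word∞ 3} (returns : ReturnsPalindromic u)
  {size : Alph 3 → ℕ} {fwd bwd : Alph 3 → Alph 3 → ℕ} (L : Level size fwd bwd w u) (adm : Admissible size fwd bwd) where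

  open Level L
  open Admissible adm
  open Bounds bounds

  private
    A = size 0₃
    B = size 1₃
    C = size 2₃
    c₀ = fwd 0₃ 2₃
    e₀ = fwd 1₃ 2₃
    d₀ = bwd 0₃ 2₃
    δ₀ = bwd 1₃ 2₃

    -- By `fwd≡` and `c≤e`, the length `c₀` serves for every pair of distinct letters.
    after : ∀ i j → u i ≢ u j → Match w (pos i) (pos j) c₀
    after i j ne with u i | u j | ne | ahead i j ne | ahead j i (ne ∘ sym)
    ... | zero | zero | ne | _ | _ = ⊥-elim (ne refl)
    ... | zero | suc zero | _ | m | _ = subst (Match w (pos i) (pos j)) fwd≡ m
    ... | zero | suc (suc zero) | _ | m | _ = m
    ... | suc zero | zero | _ | _ | m = match-sym {w = w} (subst (Match w (pos j) (pos i)) fwd≡ m)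
    ... | suc zero | suc zero | ne | _ | _ = ⊥-elim (ne refl)
    ... | suc zero | suc (suc zero) | _ | m | _ = match-≤ {w = w} c≤e m
    ... | suc (suc zero) | zero | _ | _ | m = match-sym {w = w} m
    ... | suc (suc zero) | suc zero | _ | _ | m = match-sym {w = w} (match-≤ {w = w} c≤e m)
    ... | suc (suc zero) | suc (suc zero) | ne | _ | _ = ⊥-elim (ne refl)

    before : ∀ i j {x y} → u i ≡ x → u j ≡ y → x ≢ y → MatchBefore w (pos (suc i)) (pos (suc j)) (bwd x y)
    before i j refl refl ne = behind i j ne

    nothing-before : ∀ i j → MatchBefore w (pos i) (pos j) 0
    nothing-before i j = _ , _ , refl , refl , match-zero {w = w}

    -- `xs` spells the period and `ys` is the stretch known to recur after it; `l` and `r` prolong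
    -- the agreement to the left and to the right inside `w`.
    repetition : ∀ i xs ys l r → seg u i (length xs) ≡ xs → seg u i (length ys) ≡ ys →
      seg u (length xs + i) (length ys) ≡ ys →
      MatchBefore w (pos i) (pos (length xs + i)) l →
      Match w (pos (length ys + i)) (pos (length ys + (length xs + i))) r →
      1 ≤ weight size xs → ¬ 14 * weight size xs ≤ 5 * (weight size xs + (l + (weight size ys + r)))
    repetition i xs ys l r ex ey ey′ (x , y , px , py , m) m′ 1≤p big =
      no-repetition {w = w} free x (weight size xs) _ 1≤p big
        (subst (λ y → Match w x y (l + (weight size ys + r))) y≡
          (match-++ {w = w} l m (subst₂ (λ x y → Match w x y (weight size ys + r)) px py
            (match-++ {w = w} (weight size ys)
              (subst (λ y → Match w (pos i) (pos (length xs + i)) (weight size y)) ey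
                (match-seg i (length xs + i) (length ys) (trans ey (sym ey′))))
              (subst₂ (λ x y → Match w x y r) (at i ey) (at (length xs + i) ey′) m′)))))
      where
      at : ∀ i {ys} → seg u i (length ys) ≡ ys → pos (length ys + i) ≡ weight size ys + pos i
      at i {ys} e = trans (pos-seg i (length ys)) (cong (λ y → weight size y + pos i) e)
      y≡ : y ≡ weight size xs + x
      y≡ = +-cancelˡ-≡ l y (weight size xs + x) (begin
        l + y                    ≡⟨ sym py ⟩
        pos (length xs + i)      ≡⟨ at i ex ⟩
        weight size xs + pos i   ≡⟨ cong (weight size xs +_) px ⟩
        weight size xs + (l + x) ≡⟨ sym (+-assoc (weight size xs) l x) ⟩
        (weight size xs + l) + x ≡⟨ cong (_+ x) (+-comm (weight size xs) l) ⟩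
        (l + weight size xs) + x ≡⟨ +-assoc l (weight size xs) x ⟩
        l + (weight size xs + x) ∎)

    -- The letter after the repetition either continues it, or differs from the expected letter z.
    repetition′ : ∀ i xs ys z l → seg u i (length xs) ≡ xs → seg u i (length ys) ≡ ys →
      u (length ys + i) ≡ z → seg u (length xs + i) (length ys) ≡ ys →
      MatchBefore w (pos i) (pos (length xs + i)) l → 1 ≤ weight size xs →
      14 * weight size xs ≤ 5 * (weight size xs + (l + (weight size ys + c₀))) →
      ¬ 14 * weight size xs ≤ 5 * (weight size xs + (l + (weight size ys + size z)))
    repetition′ i xs ys z l ex ey ez ey′ m 1≤p big big′ with u (length ys + i) ≟F u (length ys + (length xs + i))
    ... | yes eq = repetition i xs ys l (size z) ex ey ey′ m
      (subst (λ z → Match w (pos (length ys + i)) (pos (length ys + (length xs + i))) (size z)) ez (same _ _ eq)) 1≤p big′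
    ... | no ne = repetition i xs ys l c₀ ex ey ey′ m (after _ _ ne) 1≤p big

    -- Two blocks of length `A` prolonged by `c₀` have length `2A + c₀`, which is enough by `4A≤`; a
    -- third block gives a cube.
    avoids-00 : Avoids (0₃ ∷ 0₃ ∷ []) u
    avoids-00 i eq = repetition′ i [ 0₃ ] [ 0₃ ] 0₃ 0 (cong (take 1) eq) (cong (take 1) eq)
      (∷-injectiveˡ (∷-injectiveʳ eq)) (∷-injectiveʳ eq) (nothing-before _ _) (≤-trans A≥1 (m≤m+n A 0))
      (by-slack 0 4A≤ (s A c₀)) (by-slack A (z≤n {0}) (s′ A))
      where
      s : ∀ A c → 14 * (A + 0) + 5 * c + 0 ≡ 5 * (A + 0 + (0 + (A + 0 + c))) + 4 * A
      s = solve-∀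
      s′ : ∀ A → 14 * (A + 0) + 0 + A ≡ 5 * (A + 0 + (0 + (A + 0 + A))) + 0
      s′ = solve-∀

    -- The letter `z` before the square differs from `x`, so the repetition is prolonged by `l` on
    -- the left as well as by `c₀` on the right; with `X = size x`, the condition
    -- `14X ≤ 5(2X + l + c₀)` reduces to `4X ≤ 5(c₀ + l)`.
    square : ∀ i x z l → x ≢ z → u i ≡ z → u (1 + i) ≡ x → u (2 + i) ≡ x → l ≡ bwd z x ⊎ l ≡ bwd x z →
      1 ≤ size x → ¬ 4 * size x ≤ 5 * (c₀ + l)
    square i x z l x≢z ez ex ex′ el x≥1 big = repetition′ (suc i) [ x ] [ x ] x l (cong [_] ex) (cong [_] ex) ex′ (cong [_] ex′)
      (past el) (≤-trans x≥1 (m≤m+n (size x) 0)) (by-slack 0 big (s (size x) c₀ l)) (by-slack (size x + 5 * l) (z≤n {0}) (s′ (size x) l))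
      where
      past : l ≡ bwd z x ⊎ l ≡ bwd x z → MatchBefore w (pos (1 + i)) (pos (2 + i)) l
      past (inj₁ refl) = before i (1 + i) ez ex (x≢z ∘ sym)
      past (inj₂ refl) = matchBefore-sym {w = w} (before (1 + i) i ex ez x≢z)
      s : ∀ X c l → 14 * (X + 0) + 5 * (c + l) + 0 ≡ 5 * (X + 0 + (l + (X + 0 + c))) + 4 * X
      s = solve-∀
      s′ : ∀ X l → 14 * (X + 0) + 0 + (X + 5 * l) ≡ 5 * (X + 0 + (l + (X + 0 + X))) + 0
      s′ = solve-∀

    letters₃ : ∀ {x y z : Alph 3} {i} → seg u i 3 ≡ x ∷ y ∷ z ∷ [] → u i ≡ x × u (1 + i) ≡ y × u (2 + i) ≡ z
    letters₃ eq = ∷-injectiveˡ eq , ∷-injectiveˡ (∷-injectiveʳ eq) , ∷-injectiveˡ (∷-injectiveʳ (∷-injectiveʳ eq))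

    avoids-011 : Avoids (0₃ ∷ 1₃ ∷ 1₃ ∷ []) u
    avoids-011 i eq = let p , q , r = letters₃ eq in square i 1₃ 0₃ d₀ (λ ()) p q r (inj₁ (sym bwd≡)) B≥1 4B≤

    avoids-211 : Avoids (2₃ ∷ 1₃ ∷ 1₃ ∷ []) u
    avoids-211 i eq = let p , q , r = letters₃ eq in square i 1₃ 2₃ δ₀ (λ ()) p q r (inj₂ refl) B≥1 4B≤′

    avoids-122 : Avoids (1₃ ∷ 2₃ ∷ 2₃ ∷ []) u
    avoids-122 i eq = let p , q , r = letters₃ eq in square i 2₃ 1₃ δ₀ (λ ()) p q r (inj₁ refl) C≥1 4C≤

    cube : ∀ x → 1 ≤ size x → Avoids (x ∷ x ∷ x ∷ []) u
    cube x x≥1 i eq = repetition i [ x ] (x ∷ x ∷ []) 0 0 (cong (take 1) eq) (cong (take 2) eq) (∷-injectiveʳ eq)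
      (nothing-before _ _) (match-zero {w = w}) (≤-trans x≥1 (m≤m+n (size x) 0)) (by-slack (size x) (z≤n {0}) (s (size x)))
      where
      s : ∀ X → 14 * (X + 0) + 0 + X ≡ 5 * (X + 0 + (0 + (X + (X + 0) + 0))) + 0
      s = solve-∀

    -- The period is the single block of 1. On the left 2 is compared with 1, on the right 1 with 2,
    -- giving length `B + δ₀ + e₀` in all.
    avoids-212 : Avoids (2₃ ∷ 1₃ ∷ 2₃ ∷ []) u
    avoids-212 i eq = let p , q , r = letters₃ eq in
      repetition (suc i) [ 1₃ ] [] δ₀ e₀ (cong [_] q) refl refl
        (matchBefore-sym {w = w} (before (1 + i) i q p λ ())) (ahead′ (1 + i) (2 + i) q r λ ())
        (≤-trans B≥1 (m≤m+n B 0)) (by-slack 0 9B≤ (s B δ₀ e₀))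
      where
      ahead′ : ∀ i j {x y} → u i ≡ x → u j ≡ y → x ≢ y → Match w (pos i) (pos j) (fwd x y)
      ahead′ i j refl refl ne = ahead i j ne
      s : ∀ B δ e → 14 * (B + 0) + 5 * (δ + e) + 0 ≡ 5 * (B + 0 + (δ + (0 + e))) + 9 * B
      s = solve-∀

    avoids-10101 : Avoids (1₃ ∷ 0₃ ∷ 1₃ ∷ 0₃ ∷ 1₃ ∷ []) u
    avoids-10101 i eq = repetition′ i (1₃ ∷ 0₃ ∷ []) (1₃ ∷ 0₃ ∷ 1₃ ∷ []) 0₃ 0 (cong (take 2) eq) (cong (take 3) eq)
      (∷-injectiveˡ (cong (drop 3) eq)) (cong (drop 2) eq) (nothing-before _ _) (≤-trans B≥1 (m≤m+n B _))
      (by-slack B 4A≤ (s A B c₀)) (by-slack (A + B) (z≤n {0}) (s′ A B))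
      where
      s : ∀ A B c → 14 * (B + (A + 0)) + 5 * c + B ≡ 5 * (B + (A + 0) + (0 + (B + (A + (B + 0)) + c))) + 4 * A
      s = solve-∀
      s′ : ∀ A B → 14 * (B + (A + 0)) + 0 + (A + B) ≡ 5 * (B + (A + 0) + (0 + (B + (A + (B + 0)) + A))) + 0
      s′ = solve-∀

    -- The period is the block of `2101`, of length `A + 2B + C`. When the next letter breaks the
    -- period, the inequality needed is exactly `3B≤`.
    avoids-21012101210 : Avoids (2₃ ∷ 1₃ ∷ 0₃ ∷ 1₃ ∷ 2₃ ∷ 1₃ ∷ 0₃ ∷ 1₃ ∷ 2₃ ∷ 1₃ ∷ 0₃ ∷ []) u
    avoids-21012101210 i eq = repetition′ i (2₃ ∷ 1₃ ∷ 0₃ ∷ 1₃ ∷ []) (2₃ ∷ 1₃ ∷ 0₃ ∷ 1₃ ∷ 2₃ ∷ 1₃ ∷ 0₃ ∷ []) 1₃ 0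
      (cong (take 4) eq) (cong (take 7) eq) (∷-injectiveˡ (cong (drop 7) eq)) (cong (drop 4) eq) (nothing-before _ _)
      (≤-trans C≥1 (m≤m+n C _)) (by-slack 0 3B≤ (s A B C c₀)) (by-slack (A + B + B + C) (z≤n {0}) (s′ A B C))
      where
      s : ∀ A B C c → 14 * (C + (B + (A + (B + 0)))) + (A + C + 5 * c) + 0 ≡
        5 * (C + (B + (A + (B + 0))) + (0 + (C + (B + (A + (B + (C + (B + (A + 0)))))) + c))) + 3 * B
      s = solve-∀
      s′ : ∀ A B C → 14 * (C + (B + (A + (B + 0)))) + 0 + (A + B + B + C) ≡
        5 * (C + (B + (A + (B + 0))) + (0 + (C + (B + (A + (B + (C + (B + (A + 0)))))) + B))) + 0
      s′ = solve-∀

  forbidden-h-avoided : All (λ x → Avoids x u) forbidden-h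
  forbidden-h-avoided = avoids-00 ∷ avoids-011 ∷ cube 1₃ B≥1 ∷ avoids-122 ∷ avoids-211 ∷ avoids-212 ∷ cube 2₃ C≥1 ∷ avoids-10101
    ∷ avoids-21012101210
    ∷ letter-return returns 0₃ (1₃ ∷ 2₃ ∷ []) ((λ ()) ∷ (λ ()) ∷ []) (λ ())
    ∷ letter-return returns 2₃ (1₃ ∷ 0₃ ∷ []) ((λ ()) ∷ (λ ()) ∷ []) (λ ())
    ∷ letter-return returns 2₃ (1₃ ∷ 0₃ ∷ 1₃ ∷ 0₃ ∷ []) ((λ ()) ∷ (λ ()) ∷ (λ ()) ∷ (λ ()) ∷ []) (λ ())
    ∷ []

h-coding : ∀ {u : Word∞ 3} → All (λ x → Avoids x u) forbidden-h → ∃ λ i → ∃ λ v → Coded h v (suffix u i)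
-- A closed block of `h` has at most 4 letters, as in `0220`. The 9 further letters serve to discard
-- windows without a continuation.
h-coding {u} avoided = let j , eq = marker-sound u 0 4 (unavoidable-sound forbidden-h 4 9 (any isMarker) tt avoided 0)
  in j , parse u h (λ i eq → block-sound u h i 4 (onMarker-sound u (block h) i 3
    (unavoidable-sound forbidden-h 4 9 (onMarker (block h)) tt avoided i) eq)) j eq

-- Iterating the coding by h

apply-∘ : ∀ (φ : Morphism b c) (ψ : Morphism a b) x → apply (φ ∘ᵐ ψ) x ≡ apply φ (apply ψ x)
apply-∘ φ ψ [] = refl
apply-∘ φ ψ (x ∷ y) = trans (cong (apply φ (ψ x) ++_) (apply-∘ φ ψ y)) (sym (concatMap-++ φ (ψ x) (apply ψ y)))

-- The power is defined by applying `φ` on the outside, while each desubstitution adds a factor on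
-- the inside.
power-comm : ∀ (φ : Morphism a a) n x → apply (φ ^ᵐ n) (φ x) ≡ (φ ^ᵐ suc n) x
power-comm φ zero x = trans (concatMap-pure (φ x)) (sym (++-identityʳ (φ x)))
power-comm φ (suc n) x = trans (apply-∘ φ (φ ^ᵐ n) (φ x)) (cong (apply φ) (power-comm φ n x))

-- The induction hypothesis: besides the coding of a suffix of `w` by `Φ`, it keeps the palindromic
-- returns and the block lengths measured in `w`, from which the next excluded words are derived.
record Coding (Φ : Morphism a b) (w : Word∞ b) (size : Alph a → ℕ) (fwd bwd : Alph a → Alph a → ℕ) : Set where
  field
    index : ℕ
    word : Word∞ a
    coded : Coded Φ word (suffix w index)
    returns : ReturnsPalindromic word
    level : Level size fwd bwd w word

recode : ∀ {Φ Ψ : Morphism a b} {w size fwd bwd} → (∀ x → Φ x ≡ Ψ x) → Coding Φ w size fwd bwd → Coding Ψ w size fwd bwd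
recode eq cd = record { Coding cd ; coded = coded-cong eq (Coding.coded cd) }

trivial-coding : ∀ {w : Word∞ b} → Rich w → Coding [_] w (const 1) (λ _ _ → 0) (λ _ _ → 0)
trivial-coding {w = w} rich = record
  { index = 0
  ; word = w
  ; coded = λ m → cong (λ i → [ w i ]) (start-letters m)
  ; returns = rich⇒returns rich
  ; level = level-letters w
  }
  where
  start-letters : ∀ m → start [_] w m ≡ m
  start-letters zero = refl
  start-letters (suc m) = cong suc (start-letters m)

module _ (φ : Morphism c (suc a)) {size : Alph (suc a) → ℕ} {fwd bwd : Alph (suc a) → Alph (suc a) → ℕ} where
  open Desubstituted φ size fwd bwd using (size′; fwd′; bwd′)

  refine : ∀ {Φ : Morphism (suc a) b} {w} → Marked φ → (cd : Coding Φ w size fwd bwd) →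
    (∃ λ j → ∃ λ v → Coded φ v (suffix (Coding.word cd) j)) → Coding (Φ ∘ᵐ φ) w size′ fwd′ bwd′
  refine {Φ = Φ} {w} marked cd (j , v , φ-coded) = record
    { index = index + start Φ word j
    ; word = v
    ; coded = coded-≗ (λ k → cong w (sym (+-assoc index (start Φ word j) k))) (coded-∘ (coded-suffix coded j) φ-coded)
    ; returns = MarkedMorphism.returns-desubstitute marked φ-coded λ p r r⊑ → returns p r (⊑-suffix {w = word} j r⊑)
    ; level = Desubstituted.level φ size fwd bwd marked φ-coded (level-suffix level j)
    }
    where open Coding cd

module AtF = Desubstituted f (const 1) (λ _ _ → 0) (λ _ _ → 0)
module AtFH = Desubstituted h AtF.size′ AtF.fwd′ AtF.bwd′
module AtFG = Desubstituted g AtF.size′ AtF.fwd′ AtF.bwd′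

-- 3, 4, 7 are the lengths of `001`, `0011`, `0011011`, the images of the letters under `f` after
-- `h`; 3, 5 and 1, 3 are the values of `fwd′` and `bwd′` in `AtFH`.
bounds-FH : Bounds 3 4 7 3 5 1 3
bounds-FH = record
  { A≥1 = ≤ᵇ⇒≤ _ _ tt ; B≥1 = ≤ᵇ⇒≤ _ _ tt ; C≥1 = ≤ᵇ⇒≤ _ _ tt ; c≤e = ≤ᵇ⇒≤ _ _ tt ; e≤C+c = ≤ᵇ⇒≤ _ _ tt
  ; C≤A+B = ≤ᵇ⇒≤ _ _ tt ; 4A≤ = ≤ᵇ⇒≤ _ _ tt ; 4B≤ = ≤ᵇ⇒≤ _ _ tt ; 4B≤′ = ≤ᵇ⇒≤ _ _ tt ; 4C≤ = ≤ᵇ⇒≤ _ _ tt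
  ; 9B≤ = ≤ᵇ⇒≤ _ _ tt ; 4B≤″ = ≤ᵇ⇒≤ _ _ tt ; 3C≤ = ≤ᵇ⇒≤ _ _ tt ; 3B≤ = ≤ᵇ⇒≤ _ _ tt }

admissible-FH : Admissible AtFH.size′ AtFH.fwd′ AtFH.bwd′
admissible-FH = record { fwd≡ = refl ; bwd≡ = refl ; bounds = bounds-FH }

bounds-FG : Bounds 5 8 13 5 9 3 7
bounds-FG = record
  { A≥1 = ≤ᵇ⇒≤ _ _ tt ; B≥1 = ≤ᵇ⇒≤ _ _ tt ; C≥1 = ≤ᵇ⇒≤ _ _ tt ; c≤e = ≤ᵇ⇒≤ _ _ tt ; e≤C+c = ≤ᵇ⇒≤ _ _ tt
  ; C≤A+B = ≤ᵇ⇒≤ _ _ tt ; 4A≤ = ≤ᵇ⇒≤ _ _ tt ; 4B≤ = ≤ᵇ⇒≤ _ _ tt ; 4B≤′ = ≤ᵇ⇒≤ _ _ tt ; 4C≤ = ≤ᵇ⇒≤ _ _ tt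
  ; 9B≤ = ≤ᵇ⇒≤ _ _ tt ; 4B≤″ = ≤ᵇ⇒≤ _ _ tt ; 3C≤ = ≤ᵇ⇒≤ _ _ tt ; 3B≤ = ≤ᵇ⇒≤ _ _ tt }

admissible-FG : Admissible AtFG.size′ AtFG.fwd′ AtFG.bwd′
admissible-FG = record { fwd≡ = refl ; bwd≡ = refl ; bounds = bounds-FG }

AdmissibleCoding : Morphism 3 2 → Word∞ 2 → Set
AdmissibleCoding Φ w = ∃ λ size → ∃ λ fwd → ∃ λ bwd → Admissible size fwd bwd × Coding Φ w size fwd bwd

module _ (w : Word∞ 2) (rich : Rich w) (free : Free 14 5 w) where

  descend : ∀ Φ n → AdmissibleCoding (Φ ∘ᵐ (h ^ᵐ n)) w → AdmissibleCoding (Φ ∘ᵐ (h ^ᵐ suc n)) w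
  descend Φ n (size , fwd , bwd , adm , cd) = H.size′ , H.fwd′ , H.bwd′
    -- Both equalities hold by computation: `h(1)` and `h(2)` begin with `02` and end in 2, so from
    -- either side their first disagreement with `01` is between 1 and 2.
    , record { fwd≡ = refl ; bwd≡ = refl ; bounds = bounds-h (Admissible.bounds adm) }
    , recode (λ x → trans (apply-∘ Φ (h ^ᵐ n) (h x)) (cong (apply Φ) (power-comm h n x)))
        (refine h h-marked cd (h-coding (forbidden-h-avoided {w = w} free returns level adm)))
    where
    open Coding cd
    module H = Desubstituted h size fwd bwd

  iterate : ∀ Φ k → AdmissibleCoding (Φ ∘ᵐ (h ^ᵐ k)) w → ∀ n → AdmissibleCoding (Φ ∘ᵐ (h ^ᵐ (n + k))) w
  iterate Φ k cd zero = cd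
  iterate Φ k cd (suc n) = descend Φ (n + k) (iterate Φ k cd n)

  -- The two block sets possible at the level of `f` start the induction, with one factor `h`
  -- already present in the first case and none in the second.
  initial : AdmissibleCoding (f ∘ᵐ (h ^ᵐ 1)) w ⊎ AdmissibleCoding ((f ∘ᵐ g) ∘ᵐ (h ^ᵐ 0)) w
  initial = Sum.map by-h by-g (second-coding (forbidden-avoided {w} rich free {proj₁ first} {u} f-coded))
    where
    first = first-coding {w} rich free
    u : Word∞ 3
    u = proj₁ (proj₂ first)
    f-coded : Coded f u (suffix w (proj₁ first))
    f-coded = proj₂ (proj₂ first)
    cd : Coding f w AtF.size′ AtF.fwd′ AtF.bwd′
    cd = recode (λ x → concatMap-pure (f x)) (refine f f-marked (trivial-coding {w = w} rich) first)
    by-h : (∃ λ i → ∃ λ v → Coded h v (suffix u i)) → AdmissibleCoding (f ∘ᵐ (h ^ᵐ 1)) w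
    by-h coding = AtFH.size′ , AtFH.fwd′ , AtFH.bwd′ , admissible-FH
      , recode (λ x → cong (apply f) (sym (++-identityʳ (h x)))) (refine h h-marked cd coding)
    by-g : (∃ λ i → ∃ λ v → Coded g v (suffix u i)) → AdmissibleCoding ((f ∘ᵐ g) ∘ᵐ (h ^ᵐ 0)) w
    by-g coding = AtFG.size′ , AtFG.fwd′ , AtFG.bwd′ , admissible-FG
      , recode (λ x → sym (++-identityʳ _)) (refine g g-marked cd coding)

image-of-coding : ∀ {Φ w} → AdmissibleCoding Φ w → ∃ λ i → ∃ λ v → IsImage Φ v (suffix w i)
image-of-coding (_ , _ , _ , _ , cd) = index , word , coded⇒image coded
  where open Coding cd

theorem1 : (w : Word∞ 2) → Rich w → Free 14 5 w →
    (n : ℕ) → 1 ≤ n →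
    Σ ℕ λ i → Σ (Word∞ 3) λ wₙ →
    IsImage (f ∘ᵐ (h ^ᵐ n)) wₙ (suffix w i)
    ⊎ IsImage (f ∘ᵐ (g ∘ᵐ (h ^ᵐ n))) wₙ (suffix w i)
theorem1 w rich free (suc m) _ = Sum.[ by-h , by-g ] (initial w rich free)
  where
  n = suc m
  Goal = Σ ℕ λ i → Σ (Word∞ 3) λ wₙ → IsImage (f ∘ᵐ (h ^ᵐ n)) wₙ (suffix w i) ⊎ IsImage (f ∘ᵐ (g ∘ᵐ (h ^ᵐ n))) wₙ (suffix w i)
  by-h : AdmissibleCoding (f ∘ᵐ (h ^ᵐ 1)) w → Goal
  -- One factor `h` is already present, so `m` further steps give the power `n`.
  by-h start = let i , v , im = image-of-coding {f ∘ᵐ (h ^ᵐ n)} {w} (subst (λ n → AdmissibleCoding (f ∘ᵐ (h ^ᵐ n)) w) (+-comm m 1)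
                     (iterate w rich free f 1 start m))
    in i , v , inj₁ im
  by-g : AdmissibleCoding ((f ∘ᵐ g) ∘ᵐ (h ^ᵐ 0)) w → Goal
  by-g start = let _ , _ , _ , adm , cd = iterate w rich free (f ∘ᵐ g) 0 start n
                   i , v , im = image-of-coding {f ∘ᵐ (g ∘ᵐ (h ^ᵐ n))} {w} (_ , _ , _ , adm , recode {Ψ = f ∘ᵐ (g ∘ᵐ (h ^ᵐ n))} same-morphism cd)
    in i , v , inj₂ im
    where
    same-morphism : ∀ x → ((f ∘ᵐ g) ∘ᵐ (h ^ᵐ (n + 0))) x ≡ (f ∘ᵐ (g ∘ᵐ (h ^ᵐ n))) x
    same-morphism x = trans (apply-∘ f g ((h ^ᵐ (n + 0)) x)) (cong (λ n → apply f (apply g ((h ^ᵐ n) x))) (+-identityʳ n))
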